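{- Let $\Sigma$ be a finite alphabet. Every language $L\subseteq\Sigma^{\circledast}$ of countable words that is definable in $\mathrm{FO}[\infty]$ is definable in $\mathrm{FO[cut]}$ and is also definable in $\mathrm{WMSO}$. That is, as classes of definable languages, $\mathrm{FO}[\infty]\subseteq\mathrm{FO[cut]}\cap\mathrm{WMSO}$.
   Context: Words. A (countable) word over $\Sigma$ is a map $w$ from a countable, possibly empty, linear ordering $\mathrm{dom}(w)$ to $\Sigma$, taken up to isomorphism; $\Sigma^{\circledast}$ is the set of all such words. Infinitary rank. Let $\mathcal I_0$ be the set of nonempty finite linear orderings. For $n\ge1$, $\mathcal I_n$ is the set of (nonempty) orderings of the form $\sum_{i\in\mathbb Z}\alpha_i$ with each $\alpha_i\in\mathcal I_{n-1}$ or empty, closed under finite sums. $\mathcal I\text{ - }\mathit{rank}(\alpha)$ is the least $n$ with $\alpha\in\mathcal I_n$, and is infinite if no such $n$ exists. Logics. First-order logic FO has formulas built from $x<y$, $a(x)$ ($a\in\Sigma$; "position $x$ carries letter $a$"), boolean connectives, and $\exists x$, with variables ranging over positions of the word. $\mathrm{FO}[\infty]$ extends FO by the quantifiers $\exists^{\infty_n}x$ for all $n\in\mathbb N$, with semantics: $w,s\models\exists^{\infty_n}x\,\varphi$ iff there is $X\subseteq\mathrm{dom}(w)$ with $\mathcal I\text{ - }\mathit{rank}(X)=n$ (for the induced ordering) and $w,s[x=i]\models\varphi$ for all $i\in X$. $\mathrm{FO[cut]}$ extends FO by quantification over Dedekind cuts, i.e. over left-closed subsets $Y$ of $\mathrm{dom}(w)$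 (with the atomic membership predicate $x\in Y$). $\mathrm{WMSO}$ (weak monadic second-order logic) extends FO by quantification over finite subsets of $\mathrm{dom}(w)$ (with membership predicate). A language is definable in a logic if it is the set of words satisfying some sentence of the logic. -}

module Defs where

open import Level using (0ℓ; Lift) renaming (suc to lsuc)
open import Data.Fin.Base using (Fin)
open import Data.Integer.Base using (ℤ) renaming (_<_ to _<ᶻ_)
open import Data.Integer.Properties using (<-isStrictTotalOrder)
open import Data.Nat.Base using (ℕ; zero; suc; _<_)
open import Data.Product.Base using (Σ; Σ-syntax; ∃-syntax; _×_; _,_; proj₁)
open import Data.Sum.Base using (_⊎_)
open import Data.Sum.Relation.Binary.LeftOrder using (⊎-<-strictTotalOrder)
open import Data.Vec.Base using (Vec; []; _∷_; lookup)
open import Function.Bundles using (Inverse; _↣_; _⇔_)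
open import Relation.Binary.Bundles using (StrictTotalOrder)
open import Relation.Binary.Core using (Rel)
import Relation.Binary.Construct.On as On
open import Relation.Binary.Definitions
  using (Reflexive; Symmetric; Transitive; Trichotomous; Tri; tri<; tri≈; tri>; _Respects_)
open import Relation.Binary.Morphism.Structures using (IsOrderIsomorphism)
open import Relation.Binary.PropositionalEquality using (_≡_; refl; setoid)
open import Relation.Binary.Structures using (IsStrictTotalOrder)
open import Relation.Binary.Structures.Biased using (isStrictTotalOrderᶜ)
open import Relation.Nullary.Negation using (¬_)
open import Relation.Unary using (Pred)

-- Orderings carry a setoid equality, because a subset given by a
-- proof-relevant predicate is only a subset up to equality of the first
-- components (see _↾_).

LinOrd : Set₁
LinOrd = StrictTotalOrder 0ℓ 0ℓ 0ℓ

∣_∣ : LinOrd → Set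
∣ α ∣ = StrictTotalOrder.Carrier α

infix 4 _≅_

_≅_ : LinOrd → LinOrd → Set
α ≅ β = ∃[ f ] IsOrderIsomorphism α._≈_ β._≈_ α._<_ β._<_ f
  where
  module α = StrictTotalOrder α
  module β = StrictTotalOrder β

NonEmpty Empty Finite : LinOrd → Set
NonEmpty α = ∣ α ∣
Empty α    = ¬ ∣ α ∣
Finite α   = ∃[ k ] Inverse (StrictTotalOrder.Eq.setoid α) (setoid (Fin k))

_↾_ : (α : LinOrd) → Pred ∣ α ∣ 0ℓ → LinOrd
α ↾ X = On.strictTotalOrder α (proj₁ {B = X})

_⊕_ : LinOrd → LinOrd → LinOrd
α ⊕ β = ⊎-<-strictTotalOrder {d = 0ℓ} {e = 0ℓ} {f = 0ℓ} α β

module _ (α : ℤ → LinOrd) where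

  private
    module ℤ< = IsStrictTotalOrder <-isStrictTotalOrder
    module α (i : ℤ) = StrictTotalOrder (α i)

    C : Set
    C = Σ[ i ∈ ℤ ] ∣ α i ∣

  data _≈ℤ_ : Rel C 0ℓ where
    same : ∀ {i a b} → α._≈_ i a b → (i , a) ≈ℤ (i , b)

  data _<ℤ_ : Rel C 0ℓ where
    across : ∀ {i j a b} → i <ᶻ j → (i , a) <ℤ (j , b)
    within : ∀ {i a b} → α._<_ i a b → (i , a) <ℤ (i , b)

  private
    ≈-refl : Reflexive _≈ℤ_
    ≈-refl {i , a} = same (α.Eq.refl i)

    ≈-sym : Symmetric _≈ℤ_
    ≈-sym (same {i} p) = same (α.Eq.sym i p)

    ≈-trans : Transitive _≈ℤ_
    ≈-trans (same {i} p) (same q) = same (α.Eq.trans i p q)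

    <-trans : Transitive _<ℤ_
    <-trans (across p) (across q)     = across (ℤ<.trans p q)
    <-trans (across p) (within q)     = across p
    <-trans (within p) (across q)     = across q
    <-trans (within {i} p) (within q) = within (α.trans i p q)

    <-cmp : Trichotomous _≈ℤ_ _<ℤ_
    <-cmp (i , a) (j , b) with ℤ<.compare i j
    ... | tri< i<j i≢j i≯j = tri< (across i<j)
      (λ { (same _) → i≢j refl })
      (λ { (across j<i) → i≯j j<i ; (within _) → i≢j refl })
    ... | tri> i≮j i≢j j<i = tri>
      (λ { (across i<j) → i≮j i<j ; (within _) → i≢j refl })
      (λ { (same _) → i≢j refl })
      (across j<i)
    ... | tri≈ i≮i refl _ with α.compare i a b
    ...   | tri< a<b a≉b a≯b = tri< (within a<b)
      (λ { (same a≈b) → a≉b a≈b })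
      (λ { (across i<i) → i≮i i<i ; (within b<a) → a≯b b<a })
    ...   | tri≈ a≮b a≈b a≯b = tri≈
      (λ { (across i<i) → i≮i i<i ; (within a<b) → a≮b a<b })
      (same a≈b)
      (λ { (across i<i) → i≮i i<i ; (within b<a) → a≯b b<a })
    ...   | tri> a≮b a≉b b<a = tri>
      (λ { (across i<i) → i≮i i<i ; (within a<b) → a≮b a<b })
      (λ { (same a≈b) → a≉b a≈b })
      (within b<a)

  ∑ℤ : LinOrd
  ∑ℤ = record
    { Carrier            = C
    ; _≈_                = _≈ℤ_
    ; _<_                = _<ℤ_
    ; isStrictTotalOrder = isStrictTotalOrderᶜ (record
        { isEquivalence = record { refl = ≈-refl ; sym = ≈-sym ; trans = ≈-trans }
        ; trans         = <-trans
        ; compare       = <-cmp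
        })
    }

data 𝓘 : ℕ → LinOrd → Set₁ where
  finite : ∀ {β} → NonEmpty β → Finite β → 𝓘 0 β
  ℤ-sum  : ∀ {n β} (α : ℤ → LinOrd) → β ≅ ∑ℤ α → NonEmpty β →
           (∀ i → 𝓘 n (α i) ⊎ Empty (α i)) → 𝓘 (suc n) β
  ⊕-sum  : ∀ {n β} (α₁ α₂ : LinOrd) → β ≅ α₁ ⊕ α₂ →
           𝓘 (suc n) α₁ → 𝓘 (suc n) α₂ → 𝓘 (suc n) β

-- Infinite rank means that HasRank α n holds for no n.

HasRank : LinOrd → ℕ → Set₁
HasRank α n = 𝓘 n α × (∀ {m} → m < n → ¬ 𝓘 m α)

-- The injection into ℕ makes the domain finite (possibly empty) or
-- countably infinite.

record Word (A : Set) : Set₁ where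
  field
    Pos                : Set
    _≺_                : Rel Pos 0ℓ
    isStrictTotalOrder : IsStrictTotalOrder _≡_ _≺_
    countable          : Pos ↣ ℕ
    letter             : Pos → A

  dom : LinOrd
  dom = record { isStrictTotalOrder = isStrictTotalOrder }

infix 4 _≅ʷ_

_≅ʷ_ : ∀ {A} → Word A → Word A → Set
v ≅ʷ w = Σ[ (f , _) ∈ Word.dom v ≅ Word.dom w ]
         (∀ i → Word.letter w (f i) ≡ Word.letter v i)

Language : Set → Set₂
Language A = Σ (Pred (Word A) (lsuc 0ℓ)) (_Respects _≅ʷ_)

data Logic : Set where
  FO[∞] FO[cut] WMSO : Logic

-- Formula A ℒ n m has n free first-order and m free set variables (de
-- Bruijn indices).  Set variables can only be introduced by the set
-- quantifiers, so subformulas of an FO[∞] sentence have m = 0 and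
-- contain no membership atom.

data Formula (A : Set) : Logic → ℕ → ℕ → Set where
  _<′_   : ∀ {ℒ n m} → Fin n → Fin n → Formula A ℒ n m
  _at_   : ∀ {ℒ n m} → A → Fin n → Formula A ℒ n m
  _∈′_   : ∀ {ℒ n m} → Fin n → Fin m → Formula A ℒ n m
  ¬′_    : ∀ {ℒ n m} → Formula A ℒ n m → Formula A ℒ n m
  _∧′_   : ∀ {ℒ n m} → Formula A ℒ n m → Formula A ℒ n m → Formula A ℒ n m
  _∨′_   : ∀ {ℒ n m} → Formula A ℒ n m → Formula A ℒ n m → Formula A ℒ n m
  ∃′_    : ∀ {ℒ n m} → Formula A ℒ (suc n) m → Formula A ℒ n m
  ∃∞     : ∀ {n m} → ℕ → Formula A FO[∞] (suc n) m → Formula A FO[∞] n m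
  ∃cut_  : ∀ {n m} → Formula A FO[cut] n (suc m) → Formula A FO[cut] n m
  ∃fin_  : ∀ {n m} → Formula A WMSO n (suc m) → Formula A WMSO n m

Sentence : Set → Logic → Set
Sentence A ℒ = Formula A ℒ 0 0

module _ {A : Set} (w : Word A) where
  open Word w

  LeftClosed : Pred Pos 0ℓ → Set
  LeftClosed Y = ∀ {x y} → y ≺ x → Y x → Y y

  Sat : ∀ {ℒ n m} → Vec Pos n → Vec (Pred Pos 0ℓ) m → Formula A ℒ n m → Set₁
  Sat s S (x <′ y) = Lift _ (lookup s x ≺ lookup s y)
  Sat s S (a at x) = Lift _ (letter (lookup s x) ≡ a)
  Sat s S (x ∈′ Y) = Lift _ (lookup S Y (lookup s x))
  Sat s S (¬′ φ)   = ¬ Sat s S φ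
  Sat s S (φ ∧′ ψ) = Sat s S φ × Sat s S ψ
  Sat s S (φ ∨′ ψ) = Sat s S φ ⊎ Sat s S ψ
  Sat s S (∃′ φ)   = ∃[ i ] Sat (i ∷ s) S φ
  Sat s S (∃∞ n φ) = Σ[ X ∈ Pred Pos 0ℓ ]
                     HasRank (dom ↾ X) n × (∀ i → X i → Sat (i ∷ s) S φ)
  Sat s S (∃cut φ) = Σ[ Y ∈ Pred Pos 0ℓ ] LeftClosed Y × Sat s (Y ∷ S) φ
  Sat s S (∃fin φ) = Σ[ X ∈ Pred Pos 0ℓ ] Finite (dom ↾ X) × Sat s (X ∷ S) φ

infix 4 _⊨_

_⊨_ : ∀ {A ℒ} → Word A → Sentence A ℒ → Set₁
w ⊨ φ = Sat w [] [] φ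

DefinableIn : ∀ {A} → Logic → Language A → Set₁
DefinableIn {A} ℒ (L , _) = Σ[ φ ∈ Sentence A ℒ ] (∀ w → L w ⇔ w ⊨ φ)

{-# OPTIONS --safe #-}

-- Let D 0 be the nonempty orderings, and let D (n + 1) consist of the orderings
-- containing an ω- or ω*-sequence of pieces from D n; D n is partition regular.
-- 𝓘 n is disjoint from D (n + 1): for a finite sum one of the summands would again
-- be in D (n + 1), and in a ℤ-sum an inner piece of the sequence meets only
-- finitely many summands, so one of these would be in D n.  Conversely an ordering
-- of 𝓘 (n + 1) outside D (n + 1) lies in 𝓘 n, because in each of its ℤ-sums only
-- finitely many summands are in D n.  Hence a set Z of positions has a subset of
-- rank n exactly if Z is in D n.  This is expressible by recursion on n, since Z is
-- in D (n + 1) iff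
--   * for some cut Y, Y is nonempty and every x ∈ Y has some y ∈ Y with x < y and
--     Z ∩ (x , y) in D n, or dually for the complement of Y; equivalently, iff
--   * for every finite F there are x < z < y with F ∩ (x , y) empty and both
--     Z ∩ (x , z) and Z ∩ (z , y) in D n.
-- The last property yields a sequence by bisection: it is inherited by one of
-- Z ∩ (−∞ , z) and Z ∩ (z , ∞), so a piece on the other side can be split off, and
-- infinitely often this happens on the same side.
module Submission where

open import Defs
open import Level using (0ℓ; Lift; lift; lower) renaming (suc to lsuc)
open import Axiom.ExcludedMiddle using (ExcludedMiddle)
open import Data.Empty using (⊥; ⊥-elim)
open import Data.Fin.Base as Fin using (Fin; join; toℕ; punchOut; _↑ʳ_)
open import Data.Fin.Patterns using (0F; 1F; 2F; 3F)
open import Data.Fin.Properties using (pigeonhole; punchOut-injective; splitAt-join)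
open import Data.Integer.Base as ℤ using (ℤ; +_; -[1+_])
import Data.Integer.Properties as ℤₚ
open import Data.Nat.Base as ℕ using (ℕ; zero; suc; _≤_; z≤n; s≤s)
import Data.Nat.Properties as ℕₚ
open import Data.Product.Base using (Σ; Σ-syntax; ∃-syntax; _×_; _,_; proj₁; proj₂)
open import Data.Product.Function.NonDependent.Propositional using (_×-⇔_)
open import Data.Sum.Base using (_⊎_; inj₁; inj₂)
open import Data.Sum.Function.Propositional using (_⊎-⇔_)
open import Data.Sum.Properties using (inj₁-injective; inj₂-injective)
open import Data.Sum.Relation.Binary.LeftOrder using (₁∼₁; ₁∼₂; ₂∼₂; drop-inj₁; drop-inj₂)
open import Data.Sum.Relation.Binary.Pointwise as Pointwise using (inj₁; inj₂)
open import Data.Unit.Base using (⊤; tt)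
open import Data.Vec.Base using (Vec; _∷_; lookup)
open import Function.Base using (_∘_; id)
open import Function.Bundles using (Inverse; _↔_; _⇔_; mk⇔; Equivalence)
open import Function.Construct.Composition using (_⇔-∘_)
open import Function.Construct.Identity using (⇔-id)
open import Function.Construct.Symmetry using (⇔-sym)
open import Function.Related.TypeIsomorphisms using (¬-cong-⇔)
open import Relation.Binary.Bundles using (StrictTotalOrder)
open import Relation.Binary.Definitions using (tri<; tri≈; tri>)
open import Relation.Binary.Morphism.Structures using (IsOrderIsomorphism)
open import Relation.Binary.PropositionalEquality
  using (_≡_; refl; sym; trans; cong; subst)
open import Relation.Nullary using (¬_; Dec; yes; no)
open import Relation.Nullary.Decidable using (decidable-stable)
open import Relation.Unary using (Pred; ∁; _∪_)

open Equivalence using () renaming (to to to⇔; from to from⇔)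

-- Embeddings of linear orderings.

module Ord = StrictTotalOrder

infix 4 _↪_

-- Totality of both orderings makes these two conditions enough: `cancel` and `injective` follow by
-- comparing x with y. Suborderings, pieces of sequences and halves of isomorphisms are all handled
-- as such maps.
record _↪_ (α β : LinOrd) : Set where
  private
    module α = StrictTotalOrder α
    module β = StrictTotalOrder β
  field
    to     : ∣ α ∣ → ∣ β ∣
    mono   : ∀ {x y} → x α.< y → to x β.< to y
    to-cong : ∀ {x y} → x α.≈ y → to x β.≈ to y

  cancel : ∀ {x y} → to x β.< to y → x α.< y
  cancel {x} {y} p with α.compare x y
  ... | tri< x<y _ _ = x<y
  ... | tri≈ _ x≈y _ = ⊥-elim (β.irrefl (to-cong x≈y) p)
  ... | tri> _ _ y<x = ⊥-elim (β.asym p (mono y<x))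

  injective : ∀ {x y} → to x β.≈ to y → x α.≈ y
  injective {x} {y} p with α.compare x y
  ... | tri< x<y _ _ = ⊥-elim (β.irrefl p (mono x<y))
  ... | tri≈ _ x≈y _ = x≈y
  ... | tri> _ _ y<x = ⊥-elim (β.irrefl (β.Eq.sym p) (mono y<x))

open _↪_ using (to)

infixr 9 _∘↪_

_∘↪_ : ∀ {α β γ} → β ↪ γ → α ↪ β → α ↪ γ
g ∘↪ f = record
  { to      = to g ∘ to f
  ; mono    = _↪_.mono g ∘ _↪_.mono f
  ; to-cong = _↪_.to-cong g ∘ _↪_.to-cong f
  }

↾-↪ : ∀ {α} {X : Pred ∣ α ∣ 0ℓ} → (α ↾ X) ↪ α
↾-↪ = record { to = proj₁ ; mono = id ; to-cong = id }

↾-⊆ : ∀ {α} {X Y : Pred ∣ α ∣ 0ℓ} → (∀ x → X x → Y x) → (α ↾ X) ↪ (α ↾ Y)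
↾-⊆ X⊆Y = record { to = λ (x , p) → x , X⊆Y x p ; mono = id ; to-cong = id }

↾-lift : ∀ {α β} (f : α ↪ β) {X : Pred ∣ α ∣ 0ℓ} {Y : Pred ∣ β ∣ 0ℓ} →
         (∀ x → X x → Y (to f x)) → (α ↾ X) ↪ (β ↾ Y)
↾-lift f h = record
  { to      = λ (x , p) → to f x , h x p
  ; mono    = _↪_.mono f
  ; to-cong = _↪_.to-cong f
  }

↪-corestrict : ∀ {α β} (f : α ↪ β) {Y : Pred ∣ β ∣ 0ℓ} → (∀ x → Y (to f x)) → α ↪ (β ↾ Y)
↪-corestrict f h = record
  { to = λ x → to f x , h x ; mono = _↪_.mono f ; to-cong = _↪_.to-cong f }

module _ {α β : LinOrd} where
  private
    module α = StrictTotalOrder α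
    module β = StrictTotalOrder β

  ↪⇒≅ : (f : α ↪ β) → (∀ y → ∃[ x ] to f x β.≈ y) → α ≅ β
  ↪⇒≅ f onto = to f , record
    { isOrderMonomorphism = record
      { isOrderHomomorphism = record { cong = _↪_.to-cong f ; mono = _↪_.mono f }
      ; injective           = _↪_.injective f
      ; cancel              = _↪_.cancel f
      }
    ; surjective = λ y → proj₁ (onto y) ,
        λ z≈x → β.Eq.trans (_↪_.to-cong f z≈x) (proj₂ (onto y))
    }

  ≅⇒↪ : α ≅ β → α ↪ β
  ≅⇒↪ (f , iso) = record { to = f ; mono = mono ; to-cong = cong′ }
    where open IsOrderIsomorphism iso renaming (cong to cong′)

  ≅⇒↩ : α ≅ β → β ↪ α
  ≅⇒↩ (f , iso) = record
    { to      = λ y → proj₁ (surjective y)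
    ; mono    = λ {x} {y} x<y →
        cancel (β.<-respʳ-≈ (β.Eq.sym (section y)) (β.<-respˡ-≈ (β.Eq.sym (section x)) x<y))
    ; to-cong = λ {x} {y} x≈y →
        injective (β.Eq.trans (section x) (β.Eq.trans x≈y (β.Eq.sym (section y))))
    }
    where
    open IsOrderIsomorphism iso
    section : ∀ y → f (proj₁ (surjective y)) β.≈ y
    section y = proj₂ (surjective y) α.Eq.refl

-- Directed sequences and the hierarchy `D`.

data Dir : Set where
  up down : Dir

-- With the direction as a parameter, ω-sequences (`up`) and ω*-sequences (`down`) share their
-- proofs.
lt : ∀ α → Dir → ∣ α ∣ → ∣ α ∣ → Set
lt α up   x y = StrictTotalOrder._<_ α x y
lt α down x y = StrictTotalOrder._<_ α y x

lt-mono : ∀ {α β} (f : α ↪ β) d {x y} → lt α d x y → lt β d (to f x) (to f y)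
lt-mono f up   = _↪_.mono f
lt-mono f down = _↪_.mono f

lt-↾ : ∀ {α} {X : Pred ∣ α ∣ 0ℓ} d {x y : ∣ α ↾ X ∣} →
       lt α d (proj₁ x) (proj₁ y) → lt (α ↾ X) d x y
lt-↾ up   = id
lt-↾ down = id

lt-trans : ∀ α d {x y z} → lt α d x y → lt α d y z → lt α d x z
lt-trans α up   p q = Ord.trans α p q
lt-trans α down p q = Ord.trans α q p

lt-irrefl : ∀ α d {x y} → Ord._≈_ α x y → ¬ lt α d x y
lt-irrefl α up   e p = Ord.irrefl α e p
lt-irrefl α down e p = Ord.irrefl α (Ord.Eq.sym α e) p

step⇒inc : ∀ α d (p : ℕ → ∣ α ∣) → (∀ i → lt α d (p i) (p (suc i))) →
           ∀ {i j} → i ℕ.< j → lt α d (p i) (p j)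
step⇒inc α d p step {i} i<j = go (ℕₚ.≤⇒≤′ i<j)
  where
  go : ∀ {j} → suc i ℕ.≤′ j → lt α d (p i) (p j)
  go (ℕ.≤′-reflexive refl) = step i
  go (ℕ.≤′-step q)         = lt-trans α d (go q) (step _)

-- The pieces are separate orderings with embeddings rather than subsets of β, so passing to a
-- larger ordering is mere composition (`D-map`). They need not be convex.
D : ℕ → LinOrd → Set₁
D zero    β = Lift _ ∣ β ∣
D (suc n) β = Σ[ d ∈ Dir ] Σ[ γ ∈ (ℕ → LinOrd) ] (∀ i → D n (γ i)) ×
  Σ[ f ∈ (∀ i → γ i ↪ β) ] (∀ {i j} → i ℕ.< j → ∀ x y → lt β d (to (f i) x) (to (f j) y))

D-point : ∀ n {β} → D n β → ∣ β ∣
D-point zero    (lift x)           = x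
D-point (suc n) (_ , _ , h , f , _) = to (f 0) (D-point n (h 0))

D-map : ∀ n {α β} → α ↪ β → D n α → D n β
D-map zero    e (lift x) = lift (to e x)
D-map (suc n) e (d , γ , h , f , o) =
  d , γ , h , (λ i → e ∘↪ f i) , λ i<j x y → lt-mono e d (o i<j x y)

D-suc : ∀ n {β} → D (suc n) β → D n β
D-suc n (_ , _ , h , f , _) = D-map n (f 0) (h 0)

D-≤ : ∀ {m n β} → m ≤ n → D n β → D m β
D-≤ {m} {n} {β} m≤n = go (ℕₚ.≤⇒≤′ m≤n)
  where
  go : ∀ {n} → m ℕ.≤′ n → D n β → D m β
  go (ℕ.≤′-reflexive refl) = id
  go (ℕ.≤′-step q)         = go q ∘ D-suc _

-- Decomposing an ordering embedded in a sum.

split-⊕ : ∀ {α γ₁ γ₂} → α ↪ (γ₁ ⊕ γ₂) → Σ[ α₁ ∈ LinOrd ] Σ[ α₂ ∈ LinOrd ]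
          α ≅ (α₁ ⊕ α₂) × (α₁ ↪ γ₁) × (α₂ ↪ γ₂)
split-⊕ {α} {γ₁} {γ₂} e = α₁ , α₂ , ↪⇒≅ e′ onto ,
  record { to      = λ (_ , a , _) → a
         ; mono    = λ { {_ , _ , p} {_ , _ , q} r → drop-inj₁ (lt′ p q r) }
         ; to-cong = λ { {_ , _ , p} {_ , _ , q} r → Pointwise.drop-inj₁ (eq′ p q r) } } ,
  record { to      = λ (_ , a , _) → a
         ; mono    = λ { {_ , _ , p} {_ , _ , q} r → drop-inj₂ (lt′ p q r) }
         ; to-cong = λ { {_ , _ , p} {_ , _ , q} r → Pointwise.drop-inj₂ (eq′ p q r) } }
  where
  module α = StrictTotalOrder α
  module γ = StrictTotalOrder (γ₁ ⊕ γ₂)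
  α₁ = α ↾ λ x → ∃[ a ] to e x ≡ inj₁ a
  α₂ = α ↾ λ x → ∃[ a ] to e x ≡ inj₂ a
  -- The images are generalised to variables u and v, so that they can be matched on as `inj₁` or
  -- `inj₂`.
  lt′ : ∀ {x y u v} → to e x ≡ u → to e y ≡ v → x α.< y → u γ.< v
  lt′ refl refl = _↪_.mono e
  eq′ : ∀ {x y u v} → to e x ≡ u → to e y ≡ v → x α.≈ y → u γ.≈ v
  eq′ refl refl = _↪_.to-cong e
  side : ∀ x u → to e x ≡ u → ∣ α₁ ⊕ α₂ ∣
  side x (inj₁ a) p = inj₁ (x , a , p)
  side x (inj₂ a) p = inj₂ (x , a , p)
  side-mono : ∀ {x y} u v p q → x α.< y → Ord._<_ (α₁ ⊕ α₂) (side x u p) (side y v q)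
  side-mono (inj₁ _) (inj₁ _) p q r = ₁∼₁ r
  side-mono (inj₁ _) (inj₂ _) p q r = ₁∼₂
  side-mono (inj₂ _) (inj₂ _) p q r = ₂∼₂ r
  side-mono (inj₂ _) (inj₁ _) p q r with () ← lt′ p q r
  side-cong : ∀ {x y} u v p q → x α.≈ y → Ord._≈_ (α₁ ⊕ α₂) (side x u p) (side y v q)
  side-cong (inj₁ _) (inj₁ _) p q r = inj₁ r
  side-cong (inj₂ _) (inj₂ _) p q r = inj₂ r
  side-cong (inj₁ _) (inj₂ _) p q r with () ← eq′ p q r
  side-cong (inj₂ _) (inj₁ _) p q r with () ← eq′ p q r
  e′ : α ↪ (α₁ ⊕ α₂)
  e′ = record { to = λ x → side x _ refl
              ; mono = side-mono _ _ refl refl ; to-cong = side-cong _ _ refl refl }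
  onto : ∀ y → ∃[ x ] Ord._≈_ (α₁ ⊕ α₂) (to e′ x) y
  onto (inj₁ (x , a , p)) = x , side-cong _ (inj₁ a) refl p α.Eq.refl
  onto (inj₂ (x , a , p)) = x , side-cong _ (inj₂ a) refl p α.Eq.refl

module _ {γ : ℤ → LinOrd} where
  private module γ = StrictTotalOrder (∑ℤ γ)

  proj₁-mono : ∀ {u v} → u γ.< v → proj₁ u ℤ.≤ proj₁ v
  proj₁-mono (across i<j) = ℤₚ.<⇒≤ i<j
  proj₁-mono (within _)   = ℤₚ.≤-refl

  module _ {α} (e : α ↪ ∑ℤ γ) where
    private module α = StrictTotalOrder α

    Fibre : ℤ → Pred ∣ α ∣ 0ℓ
    Fibre i x = ∃[ a ] to e x ≡ (i , a)

    index : ∣ α ∣ → ℤ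
    index x = proj₁ (to e x)

    index⇒Fibre : ∀ {x i} → index x ≡ i → Fibre i x
    index⇒Fibre refl = _ , refl

    private
      drop-< : ∀ {i a b} → (i , a) γ.< (i , b) → Ord._<_ (γ i) a b
      drop-< (within p) = p
      drop-< (across p) = ⊥-elim (ℤₚ.<-irrefl refl p)
      drop-≈ : ∀ {i a b} → (i , a) γ.≈ (i , b) → Ord._≈_ (γ i) a b
      drop-≈ (same p) = p
      lt′ : ∀ {x y u v} → to e x ≡ u → to e y ≡ v → x α.< y → u γ.< v
      lt′ refl refl = _↪_.mono e
      eq′ : ∀ {x y u v} → to e x ≡ u → to e y ≡ v → x α.≈ y → u γ.≈ v
      eq′ refl refl = _↪_.to-cong e

    Fibre-↪ : ∀ i → (α ↾ Fibre i) ↪ γ i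
    Fibre-↪ i = record
      { to      = λ (_ , a , _) → a
      ; mono    = λ { {_ , _ , p} {_ , _ , q} r → drop-< (lt′ p q r) }
      ; to-cong = λ { {_ , _ , p} {_ , _ , q} r → drop-≈ (eq′ p q r) }
      }

    private
      δ : ℤ → LinOrd
      δ i = α ↾ Fibre i
      tag-mono : ∀ {x y i a j b} (p : to e x ≡ (i , a)) (q : to e y ≡ (j , b)) → x α.< y →
                 Ord._<_ (∑ℤ δ) (i , x , a , p) (j , y , b , q)
      tag-mono p q r with lt′ p q r
      ... | within _ = within r
      ... | across s = across s
      tag-cong : ∀ {x y i a j b} (p : to e x ≡ (i , a)) (q : to e y ≡ (j , b)) → x α.≈ y →
                 Ord._≈_ (∑ℤ δ) (i , x , a , p) (j , y , b , q)
      tag-cong p q r with eq′ p q r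
      ... | same _ = same r

    -- The index map is monotone, so its fibres, some possibly empty, arrange α as a ℤ-sum again.
    -- This is what carries the ℤ-sum case over to suborderings.
    ≅∑-Fibre : α ≅ ∑ℤ (λ i → α ↾ Fibre i)
    ≅∑-Fibre = ↪⇒≅ {α} {∑ℤ δ}
      (record { to = λ x → proj₁ (to e x) , x , proj₂ (to e x) , refl
              ; mono = tag-mono refl refl ; to-cong = tag-cong refl refl })
      λ (i , x , a , p) → x , tag-cong refl p α.Eq.refl

-- The index shift lets the empty orderings start the inductions on rank.
𝓙 : ℕ → LinOrd → Set₁
𝓙 zero    β = Lift _ (Empty β)
𝓙 (suc n) β = 𝓘 n β ⊎ Empty β

Empty⇒𝓙 : ∀ n {β} → Empty β → 𝓙 n β
Empty⇒𝓙 zero    = lift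
Empty⇒𝓙 (suc n) = inj₂

-- Auxiliary facts on sums and integers.

join-injective : ∀ m n {x y : Fin m ⊎ Fin n} → join m n x ≡ join m n y → x ≡ y
join-injective m n {x} {y} p =
  trans (sym (splitAt-join m n x)) (trans (cong (Fin.splitAt m) p) (splitAt-join m n y))

⊕-drop-↪ˡ : ∀ α β → Empty α → (α ⊕ β) ↪ β
⊕-drop-↪ˡ α β empty = record
  { to      = λ { (inj₁ x) → ⊥-elim (empty x) ; (inj₂ y) → y }
  ; mono    = λ { (₁∼₂ {x}) → ⊥-elim (empty x) ; (₁∼₁ {x} _) → ⊥-elim (empty x) ; (₂∼₂ p) → p }
  ; to-cong = λ { (inj₁ {x} _) → ⊥-elim (empty x) ; (inj₂ p) → p }
  }

⊕-drop-↪ʳ : ∀ α β → Empty β → (α ⊕ β) ↪ α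
⊕-drop-↪ʳ α β empty = record
  { to      = λ { (inj₁ x) → x ; (inj₂ y) → ⊥-elim (empty y) }
  ; mono    = λ { (₁∼₂ {_} {y}) → ⊥-elim (empty y) ; (₁∼₁ p) → p ; (₂∼₂ {x} _) → ⊥-elim (empty x) }
  ; to-cong = λ { (inj₁ p) → p ; (inj₂ {x} _) → ⊥-elim (empty x) }
  }

𝓘-nonempty : ∀ {n β} → 𝓘 n β → ∣ β ∣
𝓘-nonempty (finite x _)       = x
𝓘-nonempty (ℤ-sum _ _ x _)    = x
𝓘-nonempty {β = β} (⊕-sum α₁ α₂ i d _) = to (≅⇒↩ {β} {α₁ ⊕ α₂} i) (inj₁ (𝓘-nonempty d))

≅-refl : ∀ β → β ≅ β
≅-refl β = ↪⇒≅ {β} {β} (record { to = id ; mono = id ; to-cong = id }) λ y → y , Ord.Eq.refl β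

≤⇒∃+ : ∀ {i j} → i ℤ.≤ j → ∃[ k ] i ℤ.+ + k ≡ j
≤⇒∃+ {i} {j} i≤j = ℤ.∣ j ℤ.- i ∣ , trans
  (cong (ℤ._+_ i) (ℤₚ.0≤i⇒+∣i∣≡i (ℤₚ.i≤j⇒0≤j-i i≤j)))
  (trans (cong (ℤ._+_ i) (ℤₚ.+-comm j (ℤ.- i)))
  (trans (sym (ℤₚ.+-assoc i (ℤ.- i) j))
  (trans (cong (ℤ._+ j) (ℤₚ.+-inverseʳ i)) (ℤₚ.+-identityˡ j))))

suc-shift : ∀ i k → ℤ.suc i ℤ.+ + k ≡ i ℤ.+ + suc k
suc-shift i k = trans (cong (ℤ._+ + k) (ℤₚ.+-comm (+ 1) i)) (ℤₚ.+-assoc i (+ 1) (+ k))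

inj₁-↪ : ∀ α β → α ↪ (α ⊕ β)
inj₁-↪ α β = record { to = inj₁ ; mono = ₁∼₁ ; to-cong = inj₁ }

inj₂-↪ : ∀ α β → β ↪ (α ⊕ β)
inj₂-↪ α β = record { to = inj₂ ; mono = ₂∼₂ ; to-cong = inj₂ }

IsLeft : ∀ {A B : Set} → Pred (A ⊎ B) 0ℓ
IsLeft (inj₁ _) = ⊤
IsLeft (inj₂ _) = ⊥

IsLeft-↪ : ∀ α β → ((α ⊕ β) ↾ IsLeft) ↪ α
IsLeft-↪ α β = record
  { to      = λ { (inj₁ x , _) → x }
  ; mono    = λ { {inj₁ _ , _} {inj₁ _ , _} (₁∼₁ p) → p }
  ; to-cong = λ { {inj₁ _ , _} {inj₁ _ , _} (inj₁ p) → p }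
  }

∁IsLeft-↪ : ∀ α β → ((α ⊕ β) ↾ ∁ IsLeft) ↪ β
∁IsLeft-↪ α β = record
  { to      = λ { (inj₁ _ , p) → ⊥-elim (p tt) ; (inj₂ y , _) → y }
  ; mono    = λ { {inj₁ _ , p} → ⊥-elim (p tt)
                ; {_} {inj₁ _ , p} → ⊥-elim (p tt)
                ; {inj₂ _ , _} {inj₂ _ , _} (₂∼₂ p) → p }
  ; to-cong = λ { {inj₁ _ , p} → ⊥-elim (p tt)
                ; {_} {inj₁ _ , p} → ⊥-elim (p tt)
                ; {inj₂ _ , _} {inj₂ _ , _} (inj₂ p) → p }
  }

-- Formulas expressing membership in `D`.

Σ-cong-⇔ : ∀ {a b c} {A : Set a} {B : A → Set b} {C : A → Set c} →
           (∀ x → B x ⇔ C x) → Σ A B ⇔ Σ A C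
Σ-cong-⇔ h = mk⇔ (λ (x , p) → x , to⇔ (h x) p) (λ (x , p) → x , from⇔ (h x) p)

rename : ∀ {A ℒ n n′ m m′} → (Fin n → Fin n′) → (Fin m → Fin m′) →
         Formula A ℒ n m → Formula A ℒ n′ m′
rename ρ σ (x <′ y) = ρ x <′ ρ y
rename ρ σ (a at x) = a at ρ x
rename ρ σ (x ∈′ Y) = ρ x ∈′ σ Y
rename ρ σ (¬′ φ)   = ¬′ rename ρ σ φ
rename ρ σ (φ ∧′ ψ) = rename ρ σ φ ∧′ rename ρ σ ψ
rename ρ σ (φ ∨′ ψ) = rename ρ σ φ ∨′ rename ρ σ ψ
rename ρ σ (∃′ φ)   = ∃′ rename (Fin.lift 1 ρ) σ φ
rename ρ σ (∃∞ n φ) = ∃∞ n (rename (Fin.lift 1 ρ) σ φ)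
rename ρ σ (∃cut φ) = ∃cut rename ρ (Fin.lift 1 σ) φ
rename ρ σ (∃fin φ) = ∃fin rename ρ (Fin.lift 1 σ) φ

lookup-lift : ∀ {a} {B : Set a} {n n′} {s : Vec B n} {s′ : Vec B n′} {ρ : Fin n → Fin n′} →
              (∀ i → lookup s′ (ρ i) ≡ lookup s i) →
              ∀ x i → lookup (x ∷ s′) (Fin.lift 1 ρ i) ≡ lookup (x ∷ s) i
lookup-lift h x Fin.zero    = refl
lookup-lift h x (Fin.suc i) = h i

insert : ∀ k {n} → Fin (suc n) → Fin (suc (k ℕ.+ n))
insert k Fin.zero    = Fin.zero
insert k (Fin.suc i) = Fin.suc (k ↑ʳ i)

less : ∀ {A ℒ n m} → Dir → Fin n → Fin n → Formula A ℒ n m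
less up   x y = x <′ y
less down x y = y <′ x

-- The k new first-order variables come after the one bound by the
-- quantifier for which the formula is intended.
between : ∀ {A ℒ n m} → Dir → ∀ k (x y : Fin (k ℕ.+ n)) →
          Formula A ℒ (suc n) m → Formula A ℒ (suc (k ℕ.+ n)) (suc m)
between d k x y φ =
  rename (insert k) Fin.suc φ ∧′ (less d (Fin.suc x) Fin.zero ∧′ less d Fin.zero (Fin.suc y))

onSide : ∀ {A ℒ n m} → Dir → Formula A ℒ (suc n) (suc m)
onSide up   = 0F ∈′ 0F
onSide down = ¬′ (0F ∈′ 0F)

-- The statement "every x on the side has a later y on the side with ψ" is written with two
-- negations. In ψ, `1F` is x and `0F` is y.
limit : ∀ {A ℒ n m} → Dir → Formula A ℒ (suc (suc n)) (suc m) → Formula A ℒ n (suc m)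
limit d ψ = (∃′ onSide d) ∧′ (¬′ (∃′ (onSide d ∧′
              (¬′ (∃′ (onSide d ∧′ (less d 1F 0F ∧′ ψ)))))))

-- The set Z is given by φ in its first variable. Restricting Z to an interval is absorbed into φ,
-- so the recursion runs on the rank alone but must allow any number of free variables.
containsᶜ : ∀ {A n m} → ℕ → Formula A FO[cut] (suc n) m → Formula A FO[cut] n m
containsᶜ zero    φ = ∃′ φ
containsᶜ (suc k) φ = ∃cut (limit up   (containsᶜ k (between up   2 1F 0F φ)) ∨′
                            limit down (containsᶜ k (between down 2 1F 0F φ)))

containsᶠ : ∀ {A n m} → ℕ → Formula A WMSO (suc n) m → Formula A WMSO n m
containsᶠ zero    φ = ∃′ φ
containsᶠ (suc k) φ = ¬′ (∃fin (¬′ (∃′ (∃′ (∃′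
  -- Under the three quantifiers x, z, y are `2F`, `1F`, `0F`. The fourth one shifts them, so here
  -- `3F` and `1F` are x and y.
  ((¬′ (∃′ ((0F ∈′ 0F) ∧′ ((3F <′ 0F) ∧′ (0F <′ 1F))))) ∧′
   (containsᶠ k (between up 3 2F 1F φ) ∧′ containsᶠ k (between up 3 1F 0F φ))))))))

-- The replacement for the rank quantifier is a parameter, so both target logics share one
-- translation.
eliminate-∃∞ : ∀ {A ℒ} → (∀ {n m} → ℕ → Formula A ℒ (suc n) m → Formula A ℒ n m) →
               ∀ {n m} → Formula A FO[∞] n m → Formula A ℒ n m
eliminate-∃∞ c (x <′ y) = x <′ y
eliminate-∃∞ c (a at x) = a at x
eliminate-∃∞ c (x ∈′ Y) = x ∈′ Y
eliminate-∃∞ c (¬′ φ)   = ¬′ eliminate-∃∞ c φ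
eliminate-∃∞ c (φ ∧′ ψ) = eliminate-∃∞ c φ ∧′ eliminate-∃∞ c ψ
eliminate-∃∞ c (φ ∨′ ψ) = eliminate-∃∞ c φ ∨′ eliminate-∃∞ c ψ
eliminate-∃∞ c (∃′ φ)   = ∃′ eliminate-∃∞ c φ
eliminate-∃∞ c (∃∞ n φ) = c n (eliminate-∃∞ c φ)

-- Finite orderings, using excluded middle.

module Classical (em : ExcludedMiddle (lsuc 0ℓ)) where

  em₀ : (P : Set) → Dec P
  em₀ P with em {Lift _ P}
  ... | yes (lift p) = yes p
  ... | no ¬p        = no (¬p ∘ lift)

  -- Induction on k: an element a sent to zero is set aside and the elements different from a inject
  -- into the remaining k values; if there is no such a, zero is punched out.
  injection⇒Finite : ∀ k (α : LinOrd) (e : ∣ α ∣ → Fin k) →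
                     (∀ x y → e x ≡ e y → Ord._≈_ α x y) → Finite α
  injection⇒Finite zero α e inj = 0 , record
    { to = e ; from = λ () ; to-cong = λ {x} → ⊥-elim (no-elements x)
    ; from-cong = λ { {()} } ; inverse = (λ { {()} }) , λ {x} → ⊥-elim (no-elements x) }
    where
    no-elements : ¬ ∣ α ∣
    no-elements x with () ← e x
  injection⇒Finite (suc k) α e inj with em₀ (∃[ a ] e a ≡ Fin.zero)
  ... | no none = injection⇒Finite k α
    (λ x → punchOut {i = Fin.zero} {e x} (λ p → none (x , sym p)))
    (λ x y p → inj x y (punchOut-injective
      (λ q → none (x , sym q)) (λ q → none (y , sym q)) p))
  ... | yes (a , ea≡0) = suc (proj₁ finite′) , record
    { to        = λ x → go (em₀ (x α.≈ a))
    ; from      = from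
    ; to-cong   = λ p → go-cong (em₀ _) (em₀ _) p
    ; from-cong = λ { refl → α.Eq.refl }
    ; inverse   = (λ {i} p → trans (go-cong (em₀ _) (em₀ _) p) (to∘from i (em₀ _)))
                , λ { {x} refl → from∘to (em₀ _) }
    }
    where
    module α = StrictTotalOrder α
    α′ = α ↾ λ x → ¬ x α.≈ a
    e≢0 : ∀ x → ¬ x α.≈ a → ¬ Fin.zero ≡ e x
    e≢0 x x≉a p = x≉a (inj x a (trans (sym p) (sym ea≡0)))
    finite′ : Finite α′
    finite′ = injection⇒Finite k α′ (λ (x , p) → punchOut (e≢0 x p))
      (λ (x , p) (y , q) r → inj x y (punchOut-injective (e≢0 x p) (e≢0 y q) r))
    module I = Inverse (proj₂ finite′)
    -- The decision is an argument, so that the laws below hold for any decision and are proved by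
    -- matching on it.
    go : ∀ {x} → Dec (x α.≈ a) → Fin (suc (proj₁ finite′))
    go     (yes _) = Fin.zero
    go {x} (no p)  = Fin.suc (I.to (x , p))
    go-cong : ∀ {x y} (p : Dec (x α.≈ a)) (q : Dec (y α.≈ a)) → x α.≈ y → go p ≡ go q
    go-cong (yes _) (yes _) _ = refl
    go-cong (yes p) (no q)  r = ⊥-elim (q (α.Eq.trans (α.Eq.sym r) p))
    go-cong (no p)  (yes q) r = ⊥-elim (p (α.Eq.trans r q))
    go-cong (no p)  (no q)  r = cong Fin.suc (I.to-cong r)
    from : Fin (suc (proj₁ finite′)) → ∣ α ∣
    from Fin.zero    = a
    from (Fin.suc i) = proj₁ (I.from i)
    to∘from : ∀ i (p : Dec (from i α.≈ a)) → go p ≡ i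
    to∘from Fin.zero    (yes _) = refl
    to∘from Fin.zero    (no p)  = ⊥-elim (p α.Eq.refl)
    to∘from (Fin.suc i) (yes p) = ⊥-elim (proj₂ (I.from i) p)
    to∘from (Fin.suc i) (no p)  = cong Fin.suc (I.inverseˡ α.Eq.refl)
    from∘to : ∀ {x} (p : Dec (x α.≈ a)) → from (go p) α.≈ x
    from∘to (yes p) = α.Eq.sym p
    from∘to (no p)  = I.inverseʳ refl

  -- Infinite subsequences and partition regularity.

  infinitely-often : (Q : ℕ → Set₁) →
    (Σ[ s ∈ (ℕ → ℕ) ] (∀ {i j} → i ℕ.< j → s i ℕ.< s j) × (∀ i → Q (s i))) ⊎
    (Σ[ N ∈ ℕ ] (∀ i → N ≤ i → ¬ Q i))
  infinitely-often Q with em {Σ[ N ∈ ℕ ] (∀ i → N ≤ i → ¬ Q i)}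
  ... | yes h    = inj₂ h
  ... | no never = inj₁ (s , step⇒inc ℕₚ.<-strictTotalOrder up s s-step , s-Q)
    where
    next : ∀ N → Σ[ i ∈ ℕ ] N ≤ i × Q i
    next N with em {Σ[ i ∈ ℕ ] N ≤ i × Q i}
    ... | yes h = h
    ... | no h  = ⊥-elim (never (N , λ i N≤i q → h (i , N≤i , q)))
    s : ℕ → ℕ
    s zero    = proj₁ (next 0)
    s (suc k) = proj₁ (next (suc (s k)))
    s-step : ∀ k → s k ℕ.< s (suc k)
    s-step k = proj₁ (proj₂ (next (suc (s k))))
    s-Q : ∀ k → Q (s k)
    s-Q zero    = proj₂ (proj₂ (next 0))
    s-Q (suc k) = proj₂ (proj₂ (next (suc (s k))))

  infinite-pigeonhole : (Q R : ℕ → Set₁) → (∀ i → Q i ⊎ R i) →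
    (Σ[ s ∈ (ℕ → ℕ) ] (∀ {i j} → i ℕ.< j → s i ℕ.< s j) × (∀ i → Q (s i))) ⊎
    (Σ[ s ∈ (ℕ → ℕ) ] (∀ {i j} → i ℕ.< j → s i ℕ.< s j) × (∀ i → R (s i)))
  infinite-pigeonhole Q R h with infinitely-often Q
  ... | inj₁ q           = inj₁ q
  ... | inj₂ (N , never) = inj₂ (N ℕ.+_ , ℕₚ.+-monoʳ-< N , r)
    where
    r : ∀ i → R (N ℕ.+ i)
    r i with h (N ℕ.+ i)
    ... | inj₁ q = ⊥-elim (never _ (ℕₚ.m≤m+n N i) q)
    ... | inj₂ p = p

  -- By induction each piece keeps a part in `D n` inside P or outside it. One of the two happens
  -- for infinitely many pieces, and these form a sequence in the same direction.
  D-partition : ∀ n {β} (P : Pred ∣ β ∣ 0ℓ) → D n β → D n (β ↾ P) ⊎ D n (β ↾ ∁ P)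
  D-partition zero P (lift x) with em₀ (P x)
  ... | yes p = inj₁ (lift (x , p))
  ... | no ¬p = inj₂ (lift (x , ¬p))
  D-partition (suc n) {β} P (d , γ , h , f , o)
    with infinite-pigeonhole _ _ (λ i → D-partition n (P ∘ to (f i)) (h i))
  ... | inj₁ (s , inc , q) = inj₁ (d , _ , q , (λ i → ↾-lift (f (s i)) (λ _ → id)) ,
          λ { {i} {j} i<j (x , _) (y , _) → lt-↾ d (o (inc i<j) x y) })
  ... | inj₂ (s , inc , q) = inj₂ (d , _ , q , (λ i → ↾-lift (f (s i)) (λ _ → id)) ,
          λ { {i} {j} i<j (x , _) (y , _) → lt-↾ d (o (inc i<j) x y) })

  -- Closure properties of finite orderings and of `𝓙`.

  ↪-Fin⇒Finite : ∀ {α β} → α ↪ β → ∀ k (e : ∣ β ∣ → Fin k) →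
                 (∀ x y → e x ≡ e y → Ord._≈_ β x y) → Finite α
  ↪-Fin⇒Finite {α} f k e inj =
    injection⇒Finite k α (e ∘ to f) (λ x y → _↪_.injective f ∘ inj (to f x) (to f y))

  Finite-injective : ∀ α (fin : Finite α) x y →
                     Inverse.to (proj₂ fin) x ≡ Inverse.to (proj₂ fin) y → Ord._≈_ α x y
  Finite-injective α (_ , i) x y p = α.Eq.trans (α.Eq.sym (inverseʳ refl)) (inverseʳ p)
    where
    open Inverse i
    module α = StrictTotalOrder α

  Finite-↪ : ∀ {α β} → α ↪ β → Finite β → Finite α
  Finite-↪ {β = β} f fin =
    ↪-Fin⇒Finite f _ (Inverse.to (proj₂ fin)) (Finite-injective β fin)

  Finite-⊕ : ∀ α β → Finite α → Finite β → Finite (α ⊕ β)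
  Finite-⊕ α β F@(k , f) G@(l , g) = injection⇒Finite (k ℕ.+ l) (α ⊕ β) (join k l ∘ e)
    λ x y → inj x y ∘ join-injective k l
    where
    e : ∣ α ⊕ β ∣ → Fin k ⊎ Fin l
    e (inj₁ x) = inj₁ (Inverse.to f x)
    e (inj₂ y) = inj₂ (Inverse.to g y)
    inj : ∀ x y → e x ≡ e y → Ord._≈_ (α ⊕ β) x y
    inj (inj₁ x) (inj₁ y) p = inj₁ (Finite-injective α F x y (inj₁-injective p))
    inj (inj₂ x) (inj₂ y) p = inj₂ (Finite-injective β G x y (inj₂-injective p))
    inj (inj₁ _) (inj₂ _) ()
    inj (inj₂ _) (inj₁ _) ()

  mutual
    𝓙-↪ : ∀ n {α β} → α ↪ β → 𝓙 n β → 𝓙 n α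
    𝓙-↪ zero    f (lift empty) = lift (empty ∘ to f)
    𝓙-↪ (suc n) f (inj₂ empty) = inj₂ (empty ∘ to f)
    𝓙-↪ (suc n) {α} f (inj₁ d) with em₀ ∣ α ∣
    ... | yes x     = inj₁ (𝓘-↪ n f x d)
    ... | no empty  = inj₂ empty

    -- Induction on the derivation: α is the sum of the preimages of the summands, each of which
    -- embeds in its summand.
    𝓘-↪ : ∀ n {α β} → α ↪ β → ∣ α ∣ → 𝓘 n β → 𝓘 n α
    𝓘-↪ zero f x (finite _ fin) = finite x (Finite-↪ f fin)
    𝓘-↪ (suc n) f x (ℤ-sum γ iso _ h) =
      ℤ-sum _ (≅∑-Fibre g) x (λ i → 𝓙-↪ (suc n) (Fibre-↪ g i) (h i))
      where g = ≅⇒↪ {β = ∑ℤ γ} iso ∘↪ f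
    𝓘-↪ (suc n) f x (⊕-sum γ₁ γ₂ iso d₁ d₂) with split-⊕ {γ₁ = γ₁} {γ₂}
                                             (≅⇒↪ {β = γ₁ ⊕ γ₂} iso ∘↪ f)
    ... | α₁ , α₂ , iso′ , g₁ , g₂ with em₀ ∣ α₁ ∣ | em₀ ∣ α₂ ∣
    ...   | yes x₁ | yes x₂ = ⊕-sum α₁ α₂ iso′ (𝓘-↪ (suc n) g₁ x₁ d₁) (𝓘-↪ (suc n) g₂ x₂ d₂)
    -- `⊕-sum` takes only summands in `𝓘`, which are nonempty; an empty preimage is dropped and α
    -- embeds in the other summand.
    ...   | no ∅₁  | _      =
      𝓘-↪ (suc n) (g₂ ∘↪ ⊕-drop-↪ˡ α₁ α₂ ∅₁ ∘↪ ≅⇒↪ {β = α₁ ⊕ α₂} iso′) x d₂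
    ...   | yes _  | no ∅₂  =
      𝓘-↪ (suc n) (g₁ ∘↪ ⊕-drop-↪ʳ α₁ α₂ ∅₂ ∘↪ ≅⇒↪ {β = α₁ ⊕ α₂} iso′) x d₁

  𝓙-⊕ : ∀ n α β → 𝓙 n α → 𝓙 n β → 𝓙 n (α ⊕ β)
  𝓙-⊕ zero α β (lift ∅₁) (lift ∅₂) = lift λ { (inj₁ x) → ∅₁ x ; (inj₂ y) → ∅₂ y }
  𝓙-⊕ (suc n) α β (inj₂ ∅₁) j = 𝓙-↪ (suc n) (⊕-drop-↪ˡ α β ∅₁) j
  𝓙-⊕ (suc n) α β (inj₁ d) (inj₂ ∅₂) = 𝓙-↪ (suc n) (⊕-drop-↪ʳ α β ∅₂) (inj₁ d)
  -- `⊕-sum` starts at rank 1, so at rank 0 the sum must be shown finite.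
  𝓙-⊕ (suc zero) α β (inj₁ (finite x F)) (inj₁ (finite _ G)) =
    inj₁ (finite (inj₁ x) (Finite-⊕ α β F G))
  𝓙-⊕ (suc (suc n)) α β (inj₁ d) (inj₁ e) =
    inj₁ (⊕-sum α β (≅-refl (α ⊕ β)) d e)

  𝓙-∑ℤ : ∀ n α → (∀ i → 𝓙 n (α i)) → 𝓙 (suc n) (∑ℤ α)
  𝓙-∑ℤ zero α h = inj₂ λ (i , x) → lower (h i) x
  𝓙-∑ℤ (suc n) α h with em₀ ∣ ∑ℤ α ∣
  ... | no empty = inj₂ empty
  ... | yes x    = inj₁ (ℤ-sum α (≅-refl (∑ℤ α)) x h)

  -- An embedding is all that `𝓙-initial` requires, since `𝓙` is closed under suborderings. The
  -- hypothesis also makes P respect equality: equal elements on different sides would be strictly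
  -- ordered.
  initial-↪ : ∀ β (P : Pred ∣ β ∣ 0ℓ) → (∀ {x y} → P x → ¬ P y → Ord._<_ β x y) →
              β ↪ ((β ↾ P) ⊕ (β ↾ ∁ P))
  initial-↪ β P initial = record
    { to = λ x → side (em₀ (P x)) ; mono = side-mono (em₀ _) (em₀ _)
    ; to-cong = side-cong (em₀ _) (em₀ _) }
    where
    module β = StrictTotalOrder β
    side : ∀ {x} → Dec (P x) → ∣ (β ↾ P) ⊕ (β ↾ ∁ P) ∣
    side (yes p) = inj₁ (_ , p)
    side (no ¬p) = inj₂ (_ , ¬p)
    side-mono : ∀ {x y} (p : Dec (P x)) (q : Dec (P y)) → x β.< y →
                Ord._<_ ((β ↾ P) ⊕ (β ↾ ∁ P)) (side p) (side q)
    side-mono (yes _) (yes _) r = ₁∼₁ r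
    side-mono (yes _) (no _)  r = ₁∼₂
    side-mono (no p)  (yes q) r = ⊥-elim (β.asym r (initial q p))
    side-mono (no _)  (no _)  r = ₂∼₂ r
    side-cong : ∀ {x y} (p : Dec (P x)) (q : Dec (P y)) → x β.≈ y →
                Ord._≈_ ((β ↾ P) ⊕ (β ↾ ∁ P)) (side p) (side q)
    side-cong (yes _) (yes _) r = inj₁ r
    side-cong (yes p) (no q)  r = ⊥-elim (β.irrefl r (initial p q))
    side-cong (no p)  (yes q) r = ⊥-elim (β.irrefl (β.Eq.sym r) (initial q p))
    side-cong (no _)  (no _)  r = inj₂ r

  𝓙-initial : ∀ n {β} (P : Pred ∣ β ∣ 0ℓ) → (∀ {x y} → P x → ¬ P y → Ord._<_ β x y) →
              𝓙 n (β ↾ P) → 𝓙 n (β ↾ ∁ P) → 𝓙 n β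
  𝓙-initial n {β} P initial j k = 𝓙-↪ n (initial-↪ β P initial) (𝓙-⊕ n _ _ j k)

  -- Parts of ℤ-sums meeting a bounded or half-bounded range of summands.

  module _ {γ : ℤ → LinOrd} where

    -- Only the k summands from lo up to, but excluding, hi are met. Partition regularity peels off
    -- the fibre at lo, which is not in `D m`, until nothing is left.
    bounded⇒¬D : ∀ m → (∀ i → ¬ D m (γ i)) → ∀ k {lo hi} → lo ℤ.+ + k ≡ hi →
      ∀ {β} (e : β ↪ ∑ℤ γ) → (∀ x → lo ℤ.≤ index e x) → (∀ x → index e x ℤ.< hi) → ¬ D m β
    bounded⇒¬D m ¬Dγ zero {lo} refl e lo≤ <hi d =
      ℤₚ.<-irrefl refl (ℤₚ.≤-<-trans (lo≤ x)
        (subst (index e x ℤ.<_) (ℤₚ.+-identityʳ lo) (<hi x)))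
      where x = D-point m d
    bounded⇒¬D m ¬Dγ (suc k) {lo} p {β} e lo≤ <hi d with D-partition m (Fibre e lo) d
    ... | inj₁ d₁ = ¬Dγ lo (D-map m (Fibre-↪ e lo) d₁)
    ... | inj₂ d₂ = bounded⇒¬D m ¬Dγ k (trans (suc-shift lo k) p) (e ∘↪ ↾-↪)
      (λ (x , x∉) → ℤₚ.i<j⇒suc[i]≤j (ℤₚ.≤∧≢⇒< (lo≤ x) (x∉ ∘ index⇒Fibre e ∘ sym)))
      (λ (x , _) → <hi x) d₂

    between⇒¬D : ∀ m → (∀ i → ¬ D m (γ i)) → ∀ d {u v β} (e : β ↪ ∑ℤ γ) →
      (∀ x → lt (∑ℤ γ) d u (to e x)) → (∀ x → lt (∑ℤ γ) d (to e x) v) → ¬ D m β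
    between⇒¬D m ¬Dγ up e u< <v d with
      -- The index range is half-open, so it ends at the successor of the index of v. A point x of β
      -- shows that it is not reversed.
      ≤⇒∃+ (ℤₚ.≤-trans (proj₁-mono (u< x)) (ℤₚ.≤-trans (proj₁-mono (<v x)) (ℤₚ.i≤suc[i] _)))
      where x = D-point m d
    ... | k , p = bounded⇒¬D m ¬Dγ k p e (proj₁-mono ∘ u<)
      (λ x → ℤₚ.≤-<-trans (proj₁-mono (<v x)) (ℤₚ.suc[i]≤j⇒i<j ℤₚ.≤-refl)) d
    between⇒¬D m ¬Dγ down e <u v< d = between⇒¬D m ¬Dγ up e v< <u d

    -- Summands that e does not meet have an empty fibre, and `𝓙 n` contains the empty orderings.
    cofinite⇒𝓙 : ∀ n {β} (e : β ↪ ∑ℤ γ) → (∀ x → 𝓙 n (γ (index e x))) → 𝓙 (suc n) β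
    cofinite⇒𝓙 n {β} e h =
      𝓙-↪ (suc n) (≅⇒↪ {β = ∑ℤ λ i → β ↾ Fibre e i} (≅∑-Fibre e))
        (𝓙-∑ℤ n (λ i → β ↾ Fibre e i) fibre)
      where
      fibre : ∀ i → 𝓙 n (β ↾ Fibre e i)
      fibre i with em₀ ∣ β ↾ Fibre e i ∣
      ... | no empty = Empty⇒𝓙 n empty
      ... | yes (x , a , p) =
        𝓙-↪ n (Fibre-↪ e i) (subst (λ j → 𝓙 n (γ j)) (cong proj₁ p) (h x))

    -- The fibres from lo up to hi are removed one by one as initial segments, each in `𝓙 (suc n)`;
    -- what remains is a ℤ-sum of orderings in `𝓙 n`.
    bounded-below⇒𝓙 : ∀ n → (∀ i → 𝓙 (suc n) (γ i)) → ∀ k {lo hi} → lo ℤ.+ + k ≡ hi →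
      (∀ i → hi ℤ.≤ i → 𝓙 n (γ i)) →
      ∀ {β} (e : β ↪ ∑ℤ γ) → (∀ x → lo ℤ.≤ index e x) → 𝓙 (suc n) β
    bounded-below⇒𝓙 n h zero {lo} refl tail e lo≤ = cofinite⇒𝓙 n e
      (λ x → tail _ (subst (ℤ._≤ index e x) (sym (ℤₚ.+-identityʳ lo)) (lo≤ x)))
    bounded-below⇒𝓙 n h (suc k) {lo} p tail {β} e lo≤ = 𝓙-initial (suc n) (Fibre e lo)
      (λ (_ , q) y∉ → _↪_.cancel e
        (subst (λ u → Ord._<_ (∑ℤ γ) u (to e _)) (sym q) (across (lo< y∉))))
      (𝓙-↪ (suc n) (Fibre-↪ e lo) (h lo))
      (bounded-below⇒𝓙 n h k (trans (suc-shift lo k) p) tail (e ∘↪ ↾-↪)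
        (λ (x , x∉) → ℤₚ.i<j⇒suc[i]≤j (lo< x∉)))
      where
      lo< : ∀ {x} → ¬ Fibre e lo x → lo ℤ.< index e x
      lo< x∉ = ℤₚ.≤∧≢⇒< (lo≤ _) (x∉ ∘ index⇒Fibre e ∘ sym)

  -- Comparing `𝓘` with `D`.

  mutual
    𝓙⇒¬D : ∀ n {β} → 𝓙 n β → ¬ D n β
    𝓙⇒¬D zero    (lift empty) (lift x) = empty x
    𝓙⇒¬D (suc n) (inj₂ empty) d = empty (D-point (suc n) d)
    𝓙⇒¬D (suc n) (inj₁ i)     d = 𝓘⇒¬D n i d

    𝓘⇒¬D : ∀ n {β} → 𝓘 n β → ¬ D (suc n) β
    𝓘⇒¬D zero {β} (finite _ fin) (d , γ , h , f , o) =
      -- One point from each of the first k + 1 pieces: two of them coincide, although the sequence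
      -- is strictly monotone.
      let i , j , i<j , p = pigeonhole (ℕₚ.n<1+n _) (λ i → Inverse.to (proj₂ fin) (x (toℕ i)))
      in lt-irrefl β d (Finite-injective β fin (x (toℕ i)) (x (toℕ j)) p) (o i<j _ _)
      where
      x : ℕ → ∣ β ∣
      x i = to (f i) (lower (h i))
    𝓘⇒¬D (suc n) (ℤ-sum γ iso _ h) (d , δ , k , f , o) =
      -- Piece 1 is the inner piece, enclosed by points of pieces 0 and 2.
      between⇒¬D (suc n) (λ i → 𝓙⇒¬D (suc n) (h i)) d (g ∘↪ f 1)
        (λ y → lt-mono g d (o (s≤s z≤n) (D-point _ (k 0)) y))
        (λ y → lt-mono g d (o (s≤s (s≤s z≤n)) y (D-point _ (k 2))))
        (k 1)
      where g = ≅⇒↪ {β = ∑ℤ γ} iso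
    𝓘⇒¬D (suc n) (⊕-sum α₁ α₂ iso i₁ i₂) d
      with D-partition _ IsLeft (D-map _ (≅⇒↪ {β = α₁ ⊕ α₂} iso) d)
    ... | inj₁ d₁ = 𝓘⇒¬D (suc n) i₁ (D-map _ (IsLeft-↪ α₁ α₂) d₁)
    ... | inj₂ d₂ = 𝓘⇒¬D (suc n) i₂ (D-map _ (∁IsLeft-↪ α₁ α₂) d₂)

  mutual
    𝓙-lower : ∀ n {β} → 𝓙 (suc n) β → ¬ D n β → 𝓙 n β
    𝓙-lower zero    _            ¬d = lift (¬d ∘ lift)
    𝓙-lower (suc n) (inj₂ empty) ¬d = inj₂ empty
    𝓙-lower (suc n) (inj₁ i)     ¬d = 𝓘-lower n i ¬d

    𝓘-lower : ∀ n {β} → 𝓘 (suc n) β → ¬ D (suc n) β → 𝓙 (suc n) β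
    𝓘-lower n (⊕-sum α₁ α₂ iso i₁ i₂) ¬d =
      𝓙-↪ (suc n) (≅⇒↪ {β = α₁ ⊕ α₂} iso) (𝓙-⊕ (suc n) α₁ α₂
        (𝓘-lower n i₁ (¬d ∘ D-map _ (≅⇒↩ {β = α₁ ⊕ α₂} iso ∘↪ inj₁-↪ α₁ α₂)))
        (𝓘-lower n i₂ (¬d ∘ D-map _ (≅⇒↩ {β = α₁ ⊕ α₂} iso ∘↪ inj₂-↪ α₁ α₂))))
    𝓘-lower n {β} (ℤ-sum γ iso _ h) ¬d
      -- Infinitely many summands in `D n` on either half of ℤ would put β in `D (suc n)`. On the
      -- negative half they run downwards as k grows.
      with infinitely-often (λ k → D n (γ (+ k))) | infinitely-often (λ k → D n (γ -[1+ k ]))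
    ... | inj₁ (s , inc , q) | _ = ⊥-elim (¬d (D-map (suc n) (≅⇒↩ {β = ∑ℤ γ} iso)
        (up , _ , q , (λ i → record { to = λ x → _ , x ; mono = within ; to-cong = same })
        , λ i<j _ _ → across (ℤ.+<+ (inc i<j)))))
    ... | inj₂ _ | inj₁ (s , inc , q) = ⊥-elim (¬d (D-map (suc n) (≅⇒↩ {β = ∑ℤ γ} iso)
        (down , _ , q , (λ i → record { to = λ x → _ , x ; mono = within ; to-cong = same })
        , λ i<j _ _ → across (ℤ.-<- (inc i<j)))))
    -- Below -M and from N on no summand is in `D n`, so recursion lowers these to `𝓙 n`. The
    -- finitely many in between keep `𝓙 (suc n)`.
    ... | inj₂ (N , no₊) | inj₂ (M , no₋) = 𝓙-initial (suc n) (λ x → index e x ℤ.< lo)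
        (λ x<lo y≮lo → _↪_.cancel e (<-index (ℤₚ.<-≤-trans x<lo (ℤₚ.≮⇒≥ y≮lo))))
        (cofinite⇒𝓙 n (e ∘↪ ↾-↪) (λ (x , x<lo) → left _ x<lo))
        (bounded-below⇒𝓙 n h (proj₁ gap) (proj₂ gap) right (e ∘↪ ↾-↪)
          (λ (_ , x≮lo) → ℤₚ.≮⇒≥ x≮lo))
      where
      e : β ↪ ∑ℤ γ
      e = ≅⇒↪ {β = ∑ℤ γ} iso
      lo : ℤ
      lo = ℤ.- + M
      gap : ∃[ k ] lo ℤ.+ + k ≡ + N
      gap = ≤⇒∃+ (ℤₚ.neg-≤-pos {M} {N})
      <-index : ∀ {u v} → proj₁ u ℤ.< proj₁ v → Ord._<_ (∑ℤ γ) u v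
      <-index = across
      left : ∀ i → i ℤ.< lo → 𝓙 n (γ i)
      left (+ k) k<lo = ⊥-elim (ℤₚ.≤⇒≯ (ℤₚ.neg-≤-pos {M} {k}) k<lo)
      left -[1+ k ] k<lo = 𝓙-lower n (h _) (no₋ k (bound M k k<lo))
        where
        bound : ∀ M k → -[1+ k ] ℤ.< ℤ.- + M → M ≤ k
        bound zero    k _             = z≤n
        bound (suc M) k (ℤ.-<- M<k) = M<k
      right : ∀ i → + N ℤ.≤ i → 𝓙 n (γ i)
      right (+ k) (ℤ.+≤+ N≤k) = 𝓙-lower n (h _) (no₊ k N≤k)

  -- Each piece is thinned out to a subset in `𝓘 n`, and X is their union. That X stays in `D n` is
  -- what later rules out a smaller rank.
  D⇒𝓘-subset : ∀ n {β} → D n β → Σ[ X ∈ Pred ∣ β ∣ 0ℓ ] 𝓘 n (β ↾ X) × D n (β ↾ X)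
  D⇒𝓘-subset zero {β} (lift x) = X , finite (x , Ord.Eq.refl β)
    (injection⇒Finite 1 (β ↾ X) (λ _ → Fin.zero)
      (λ (_ , p) (_ , q) _ → Ord.Eq.trans β p (Ord.Eq.sym β q))) , lift (x , Ord.Eq.refl β)
    where
    X : Pred ∣ β ∣ 0ℓ
    X y = Ord._≈_ β y x
  D⇒𝓘-subset (suc n) {β} (d , γ , h , f , o) =
    X , 𝓘-↪ (suc n) (≅⇒↩ {∑ℤ (α d)} {β ↾ X} (↪⇒≅ {∑ℤ (α d)} {β ↾ X} (e d o) (onto d o)))
          (point X₀) (ℤ-sum (α d) (≅-refl (∑ℤ (α d))) (α-point d) (α-𝓘 d))
      , d , (λ i → γ i ↾ Y i) , (λ i → proj₂ (proj₂ (D⇒𝓘-subset n (h i))))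
      , (λ i → e-at i) , λ i<j (a , _) (b , _) → lt-↾ d (o i<j a b)
    where
    Y : ∀ i → Pred ∣ γ i ∣ 0ℓ
    Y i = proj₁ (D⇒𝓘-subset n (h i))
    Y-𝓘 : ∀ i → 𝓘 n (γ i ↾ Y i)
    Y-𝓘 i = proj₁ (proj₂ (D⇒𝓘-subset n (h i)))
    X : Pred ∣ β ∣ 0ℓ
    X y = Σ[ i ∈ ℕ ] Σ[ a ∈ ∣ γ i ∣ ] Y i a × to (f i) a ≡ y
    e-at : ∀ i → (γ i ↾ Y i) ↪ (β ↾ X)
    e-at i = ↾-lift (f i) (λ a y → i , a , y , refl)
    X₀ : ∣ γ 0 ↾ Y 0 ∣
    X₀ = 𝓘-nonempty (Y-𝓘 0)
    point : ∣ γ 0 ↾ Y 0 ∣ → ∣ β ↾ X ∣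
    point = to (e-at 0)
    -- The sequence occupies the half of ℤ that fits its direction; the other half is filled with
    -- empty orderings.
    α : Dir → ℤ → LinOrd
    α up   (+ i)    = γ i ↾ Y i
    α up   -[1+ i ] = γ 0 ↾ λ _ → ⊥
    α down (+ i)    = γ 0 ↾ λ _ → ⊥
    α down -[1+ i ] = γ i ↾ Y i
    α-point : ∀ d → ∣ ∑ℤ (α d) ∣
    α-point up   = + 0 , X₀
    α-point down = -[1+ 0 ] , X₀
    α-𝓘 : ∀ d i → 𝓘 n (α d i) ⊎ Empty (α d i)
    α-𝓘 up   (+ i)    = inj₁ (Y-𝓘 i)
    α-𝓘 up   -[1+ i ] = inj₂ λ ()
    α-𝓘 down (+ i)    = inj₂ λ ()
    α-𝓘 down -[1+ i ] = inj₁ (Y-𝓘 i)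
    Ordered : Dir → Set
    Ordered d = ∀ {i j} → i ℕ.< j → ∀ x y → lt β d (to (f i) x) (to (f j) y)
    e : ∀ d → Ordered d → ∑ℤ (α d) ↪ (β ↾ X)
    e up o = record
      { to      = λ { (+ i , a) → to (e-at i) a ; (-[1+ _ ] , ()) }
      ; mono    = λ { {+ _ , _} {+ _ , _} (across (ℤ.+<+ i<j)) → o i<j _ _
                    ; { -[1+ _ ] , ()} ; {+ _ , _} { -[1+ _ ] , ()}
                    ; {+ i , _} (within p) → _↪_.mono (f i) p }
      ; to-cong = λ { {+ i , _} (same p) → _↪_.to-cong (f i) p ; { -[1+ _ ] , ()} }
      }
    e down o = record
      { to      = λ { (-[1+ i ] , a) → to (e-at i) a ; (+ _ , ()) }
      ; mono    = λ { { -[1+ _ ] , _} { -[1+ _ ] , _} (across (ℤ.-<- i<j)) → o i<j _ _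
                    ; {+ _ , ()} ; { -[1+ _ ] , _} {+ _ , ()}
                    ; { -[1+ i ] , _} (within p) → _↪_.mono (f i) p }
      ; to-cong = λ { { -[1+ i ] , _} (same p) → _↪_.to-cong (f i) p ; {+ _ , ()} }
      }
    onto : ∀ d (o : Ordered d) y → ∃[ x ] Ord._≈_ (β ↾ X) (to (e d o) x) y
    onto up   o (_ , i , a , y , refl) = (+ i , a , y) , Ord.Eq.refl β
    onto down o (_ , i , a , y , refl) = (-[1+ i ] , a , y) , Ord.Eq.refl β

  -- Sets of positions with a subset in `D n`.

  dne : ∀ {P : Set₁} → ¬ ¬ P → P
  dne = decidable-stable em

  module _ (β : LinOrd) where
    private module β = StrictTotalOrder β

    Finite-∅ : Finite (β ↾ λ _ → ⊥)
    Finite-∅ = injection⇒Finite 0 (β ↾ λ _ → ⊥) (λ ()) λ ()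

    Finite-singleton : ∀ x → Finite (β ↾ (β._≈ x))
    Finite-singleton x = injection⇒Finite 1 (β ↾ (β._≈ x)) (λ _ → Fin.zero)
      λ (_ , p) (_ , q) _ → β.Eq.trans p (β.Eq.sym q)

    Finite-∪ : ∀ {F G : Pred ∣ β ∣ 0ℓ} → Finite (β ↾ F) → Finite (β ↾ G) → Finite (β ↾ (F ∪ G))
    Finite-∪ {F} {G} fin₁@(k , f) fin₂@(l , g) =
      injection⇒Finite (k ℕ.+ l) (β ↾ (F ∪ G)) (join k l ∘ e) λ x y → inj x y ∘ join-injective k l
      where
      e : ∣ β ↾ (F ∪ G) ∣ → Fin k ⊎ Fin l
      e (x , inj₁ p) = inj₁ (Inverse.to f (x , p))
      e (x , inj₂ p) = inj₂ (Inverse.to g (x , p))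
      inj : ∀ x y → e x ≡ e y → proj₁ x β.≈ proj₁ y
      inj (x , inj₁ p) (y , inj₁ q) r = Finite-injective (β ↾ F) fin₁ _ _ (inj₁-injective r)
      inj (x , inj₂ p) (y , inj₂ q) r = Finite-injective (β ↾ G) fin₂ _ _ (inj₂-injective r)
      inj (_ , inj₁ _) (_ , inj₂ _) ()
      inj (_ , inj₂ _) (_ , inj₁ _) ()

    -- Satisfaction of a formula lives in `Set₁`, whereas `_↾_` takes predicates in `Set`; so Z is
    -- approached through small subsets X.
    HasSubsetOfRank Contains : ℕ → (∣ β ∣ → Set₁) → Set₁
    HasSubsetOfRank n Z = Σ[ X ∈ Pred ∣ β ∣ 0ℓ ] HasRank (β ↾ X) n × (∀ x → X x → Z x)
    Contains n Z        = Σ[ X ∈ Pred ∣ β ∣ 0ℓ ] D n (β ↾ X) × (∀ x → X x → Z x)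

    Contains-⊆ : ∀ n {Y Z : ∣ β ∣ → Set₁} → (∀ x → Y x → Z x) → Contains n Y → Contains n Z
    Contains-⊆ n Y⊆Z (X , d , X⊆Y) = X , d , λ x → Y⊆Z x ∘ X⊆Y x

    Contains-point : ∀ n {Z} → Contains n Z → Σ ∣ β ∣ Z
    Contains-point n (_ , d , X⊆Z) = let x , p = D-point n d in x , X⊆Z x p

    -- Outside `D n`, a subset of positive rank n would by `𝓘-lower` already lie in `𝓘` one level
    -- below.
    HasSubsetOfRank⇒Contains : ∀ n {Z} → HasSubsetOfRank n Z → Contains n Z
    HasSubsetOfRank⇒Contains n (X , (i , least) , X⊆Z) = X , dne (λ ¬d → absurd n i least ¬d) , X⊆Z
      where
      absurd : ∀ n → 𝓘 n (β ↾ X) → (∀ {m} → m ℕ.< n → ¬ 𝓘 m (β ↾ X)) → ¬ D n (β ↾ X) → ⊥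
      absurd zero    i least ¬d = ¬d (lift (𝓘-nonempty i))
      absurd (suc n) i least ¬d with 𝓘-lower n i ¬d
      ... | inj₁ i′    = least (ℕₚ.n<1+n n) i′
      ... | inj₂ empty = empty (𝓘-nonempty i)

    -- For m < n, the subset found is in `D (suc m)` because it is in `D n`, so `𝓘⇒¬D` keeps it out
    -- of `𝓘 m`.
    Contains⇒HasSubsetOfRank : ∀ n {Z} → Contains n Z → HasSubsetOfRank n Z
    Contains⇒HasSubsetOfRank n {Z} (X , d , X⊆Z) with D⇒𝓘-subset n d
    ... | Y , i , d′ = Y′ , (𝓘-↪ n e⁻¹ (to e (𝓘-nonempty i)) i ,
        λ m<n i′ → 𝓘⇒¬D _ i′ (D-≤ m<n (D-map n e d′))) , λ x (p , _) → X⊆Z x p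
      where
      Y′ : Pred ∣ β ∣ 0ℓ
      Y′ x = Σ[ p ∈ X x ] Y (x , p)
      e : ((β ↾ X) ↾ Y) ↪ (β ↾ Y′)
      e = record { to = λ ((x , p) , q) → x , p , q ; mono = id ; to-cong = id }
      e⁻¹ : (β ↾ Y′) ↪ ((β ↾ X) ↾ Y)
      e⁻¹ = record { to = λ (x , p , q) → (x , p) , q ; mono = id ; to-cong = id }

    Between : Dir → (∣ β ∣ → Set₁) → ∣ β ∣ → ∣ β ∣ → ∣ β ∣ → Set₁
    Between d Z x y v = Z v × Lift (lsuc 0ℓ) (lt β d x v) × Lift (lsuc 0ℓ) (lt β d v y)

    sequence⇒Contains : ∀ n d {Z} (Y : ℕ → ∣ β ∣ → Set₁) → (∀ i → Contains n (Y i)) →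
      (∀ i x → Y i x → Z x) → (∀ {i j} → i ℕ.< j → ∀ x y → Y i x → Y j y → lt β d x y) →
      Contains (suc n) Z
    sequence⇒Contains n d {Z} Y h Y⊆Z ordered = X ,
      (d , (λ i → β ↾ X′ i) , (λ i → proj₁ (proj₂ (h i))) , (λ i → ↾-⊆ (λ _ p → i , p)) ,
        λ { {i} {j} i<j (x , p) (y , q) →
              lt-↾ d (ordered i<j x y (X′⊆Y i x p) (X′⊆Y j y q)) }) ,
      λ x (i , p) → Y⊆Z i x (X′⊆Y i x p)
      where
      X′ : ℕ → Pred ∣ β ∣ 0ℓ
      X′ i = proj₁ (h i)
      X′⊆Y : ∀ i x → X′ i x → Y i x
      X′⊆Y i = proj₂ (proj₂ (h i))
      X : Pred ∣ β ∣ 0ℓ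
      X x = ∃[ i ] X′ i x

    Contains⇒sequence : ∀ n {Z} → Contains (suc n) Z →
      Σ[ d ∈ Dir ] Σ[ p ∈ (ℕ → ∣ β ∣) ] (∀ i → lt β d (p i) (p (suc i))) ×
      (∀ i → Contains n (Between d Z (p i) (p (suc i))))
    -- The pieces with even index supply the points, those with odd index lie
    -- strictly between them.
    Contains⇒sequence n {Z} (X , (d , γ , h , f , o) , X⊆Z) = d , p , p-step , block
      where
      pt : ∀ i → ∣ γ (i ℕ.+ i) ∣
      pt i = D-point n (h (i ℕ.+ i))
      p : ℕ → ∣ β ∣
      p i = proj₁ (to (f (i ℕ.+ i)) (pt i))
      fst : ∀ {i j} x y → i ℕ.< j → lt β d (proj₁ (to (f i) x)) (proj₁ (to (f j) y))
      fst x y i<j = lt-mono ↾-↪ d (o i<j x y)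
      2+≤ : ∀ i → suc (i ℕ.+ i) ℕ.< suc i ℕ.+ suc i
      2+≤ i = s≤s (ℕₚ.≤-reflexive (sym (ℕₚ.+-suc i i)))
      p-step : ∀ i → lt β d (p i) (p (suc i))
      p-step i = fst _ _ (ℕₚ.<-trans (ℕₚ.n<1+n _) (2+≤ i))
      block : ∀ i → Contains n (Between d Z (p i) (p (suc i)))
      block i = (λ v → ∃[ x ] proj₁ (to (f (suc (i ℕ.+ i))) x) ≡ v) ,
        D-map n (↪-corestrict (↾-↪ ∘↪ f (suc (i ℕ.+ i))) (λ x → x , refl)) (h _) ,
        λ { _ (x , refl) → X⊆Z _ (proj₂ (to (f _) x)) ,
            lift (fst _ _ (ℕₚ.n<1+n _)) , lift (fst _ _ (2+≤ i)) }

    -- The criterion by cuts.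

    Limit : ℕ → Dir → (∣ β ∣ → Set₁) → Pred ∣ β ∣ 0ℓ → Set₁
    Limit n d Z Y = (∃[ x ] Y x) ×
      (∀ x → Y x → Σ[ y ∈ ∣ β ∣ ] Y y × lt β d x y × Contains n (Between d Z x y))

    Limit⇒Contains : ∀ n d {Z Y} → Limit n d Z Y → Contains (suc n) Z
    Limit⇒Contains n d {Z} {Y} ((x₀ , y₀) , next) = sequence⇒Contains n d
      (λ i → Between d Z (p i) (p (suc i)))
      (λ i → proj₂ (proj₂ (proj₂ (next′ i))))
      (λ _ _ → proj₁)
      -- Piece i ends before `p (suc i)`, which is `p j` or precedes it, and piece j begins after
      -- `p j`.
      λ { i<j x y (_ , _ , lift x<) (_ , lift <y , _) → lt-trans β d x< (≤-lt i<j <y) }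
      where
      q : ℕ → Σ ∣ β ∣ Y
      next′ : ∀ i → Σ[ y ∈ ∣ β ∣ ] Y y × lt β d (proj₁ (q i)) y ×
                      Contains n (Between d Z (proj₁ (q i)) y)
      q zero    = x₀ , y₀
      q (suc i) = let y , p , _ = next′ i in y , p
      next′ i = next (proj₁ (q i)) (proj₂ (q i))
      p : ℕ → ∣ β ∣
      p = proj₁ ∘ q
      ≤-lt : ∀ {i j v} → i ≤ j → lt β d (p j) v → lt β d (p i) v
      ≤-lt {v = v} i≤j r with ℕₚ.m≤n⇒m<n∨m≡n i≤j
      ... | inj₂ refl = r
      ... | inj₁ i<j  = lt-trans β d (step⇒inc β d p (λ i → proj₁ (proj₂ (proj₂ (next′ i)))) i<j) r

    Contains⇒Limit : ∀ n {Z} → Contains (suc n) Z → Σ[ d ∈ Dir ] Σ[ Y ∈ Pred ∣ β ∣ 0ℓ ]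
      (∀ {x y} → lt β d y x → Y x → Y y) × Limit n d Z Y
    Contains⇒Limit n {Z} c with Contains⇒sequence n c
    -- Y closes the sequence p under predecessors in direction d. From x before `p i` one moves on
    -- to `p (suc i)`, whose interval from x includes block i.
    ... | d , p , step , block = d , (λ x → ∃[ i ] lt β d x (p i)) ,
      (λ y<x (i , x<p) → i , lt-trans β d y<x x<p) , (p 0 , 1 , step 0) ,
      λ x (i , x<p) → p (suc i) , (suc (suc i) , step (suc i)) , lt-trans β d x<p (step i) ,
        Contains-⊆ n (λ { v (z , lift l , r) → z , lift (lt-trans β d x<p l) , r }) (block i)

    -- The criterion by finite sets.

    Gap : ℕ → (∣ β ∣ → Set₁) → (A F : Pred ∣ β ∣ 0ℓ) → Set₁
    Gap n Z A F = Σ[ x ∈ ∣ β ∣ ] Σ[ z ∈ ∣ β ∣ ] Σ[ y ∈ ∣ β ∣ ]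
      (∀ v → x β.< v → v β.< y → A v × ¬ F v) ×
      Contains n (Between up Z x z) × Contains n (Between up Z z y)

    -- A is the region still under consideration in the bisection. The open interval of a gap must
    -- lie in A, but its end points may lie outside.
    Gaps : ℕ → (∣ β ∣ → Set₁) → Pred ∣ β ∣ 0ℓ → Set₁
    Gaps n Z A = ∀ F → Finite (β ↾ F) → Gap n Z A F

    Between-flip : ∀ {Z x y} v → Between down Z x y v → Between up Z y x v
    Between-flip v (z , l , r) = z , r , l

    -- The intervals come in pairs, since a gap holds two pieces. Distinct pairs are disjoint, so if
    -- F met all of them, its elements there would form an infinite monotone sequence.
    sequence-misses : ∀ d (p : ℕ → ∣ β ∣) → (∀ i → lt β d (p i) (p (suc i))) →
      ∀ F → Finite (β ↾ F) →
      ∃[ i ] (∀ v → lt β d (p (i ℕ.+ i)) v → lt β d v (p (suc (suc (i ℕ.+ i)))) → ¬ F v)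
    sequence-misses d p step F fin@(k , f)
      with em₀ (∃[ i ] (∀ v → lt β d (p (i ℕ.+ i)) v →
                        lt β d v (p (suc (suc (i ℕ.+ i)))) → ¬ F v))
    ... | yes h     = h
    ... | no all-hit =
      let i , j , i<j , e = pigeonhole (ℕₚ.n<1+n k) (λ i → Inverse.to f (F-at (toℕ i)))
      in ⊥-elim (lt-irrefl β d (Finite-injective (β ↾ F) fin (F-at (toℕ i)) (F-at (toℕ j)) e)
           (increasing i<j))
      where
      Hit : ℕ → Set
      Hit i = Σ[ v ∈ ∣ β ∣ ] lt β d (p (i ℕ.+ i)) v × lt β d v (p (suc (suc (i ℕ.+ i)))) × F v
      hit : ∀ i → Hit i
      hit i with em₀ (Hit i)
      ... | yes h = h
      ... | no ¬h = ⊥-elim (all-hit (i , λ v l r Fv → ¬h (v , l , r , Fv)))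
      F-at : ℕ → ∣ β ↾ F ∣
      F-at i = let v , _ , _ , Fv = hit i in v , Fv
      increasing : ∀ {i j} → i ℕ.< j → lt β d (proj₁ (hit i)) (proj₁ (hit j))
      increasing {i} {j} i<j
        with ℕₚ.m≤n⇒m<n∨m≡n {suc (suc (i ℕ.+ i))} {j ℕ.+ j}
               (subst (ℕ._≤ j ℕ.+ j) (cong suc (ℕₚ.+-suc i i)) (ℕₚ.+-mono-≤ i<j i<j))
      ... | inj₁ m<n = lt-trans β d (proj₁ (proj₂ (proj₂ (hit i))))
                         (lt-trans β d (step⇒inc β d p step m<n) (proj₁ (proj₂ (hit j))))
      ... | inj₂ m≡n = lt-trans β d (proj₁ (proj₂ (proj₂ (hit i))))
                         (subst (λ m → lt β d (p m) (proj₁ (hit j))) (sym m≡n)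
                           (proj₁ (proj₂ (hit j))))

    Contains⇒Gaps : ∀ n {Z} → Contains (suc n) Z → Gaps n Z (λ _ → ⊤)
    Contains⇒Gaps n c F fin with Contains⇒sequence n c
    ... | d , p , step , block with sequence-misses d p step F fin
    Contains⇒Gaps n c F fin | up , p , step , block | i , free =
      _ , _ , _ , (λ v l r → tt , free v l r) , block (i ℕ.+ i) , block (suc (i ℕ.+ i))
    -- A descending sequence meets the gap from the right: x, z, y are the points of p with indices
    -- 2i + 2, 2i + 1, 2i.
    Contains⇒Gaps n c F fin | down , p , step , block | i , free =
      _ , _ , _ , (λ v l r → tt , free v r l) ,
      Contains-⊆ n Between-flip (block (suc (i ℕ.+ i))) ,
      Contains-⊆ n Between-flip (block (i ℕ.+ i))

    module _ {n : ℕ} {Z : ∣ β ∣ → Set₁} where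

      Above Below : Pred ∣ β ∣ 0ℓ → ∣ β ∣ → Pred ∣ β ∣ 0ℓ
      Above A z v = A v × z β.< v
      Below A z v = A v × v β.< z

      -- A gap avoiding z lies on one side of z.
      Gaps-split : ∀ A z → Gaps n Z A → Gaps n Z (Above A z) ⊎ Gaps n Z (Below A z)
      Gaps-split A z gaps with em {Gaps n Z (Above A z)} | em {Gaps n Z (Below A z)}
      ... | yes g | _     = inj₁ g
      ... | no _  | yes g = inj₂ g
      ... | no ¬a | no ¬b = ⊥-elim (¬a λ F fin₁ → dne λ ¬gap₁ → ¬b λ G fin₂ → dne λ ¬gap₂ →
        impossible ¬gap₁ ¬gap₂
          (gaps ((F ∪ G) ∪ (β._≈ z)) (Finite-∪ (Finite-∪ fin₁ fin₂) (Finite-singleton z))))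
        where
        impossible : ∀ {F G} → ¬ Gap n Z (Above A z) F → ¬ Gap n Z (Below A z) G →
                     ¬ Gap n Z A ((F ∪ G) ∪ (β._≈ z))
        impossible {F} {G} ¬gap₁ ¬gap₂ (x , m , y , free , c₁ , c₂)
          with β.compare x z | β.compare z y
        ... | tri< x<z _ _ | tri< z<y _ _ = proj₂ (free z x<z z<y) (inj₂ β.Eq.refl)
        ... | tri< x<z _ _ | tri≈ _ z≈y _ = ¬gap₂ (x , m , y , (λ v x<v v<y →
                let a , v∉ = free v x<v v<y
                in (a , β.<-respʳ-≈ (β.Eq.sym z≈y) v<y) , λ p → v∉ (inj₁ (inj₂ p))) , c₁ , c₂)
        ... | tri< x<z _ _ | tri> _ _ y<z = ¬gap₂ (x , m , y , (λ v x<v v<y →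
                let a , v∉ = free v x<v v<y
                in (a , β.trans v<y y<z) , λ p → v∉ (inj₁ (inj₂ p))) , c₁ , c₂)
        ... | tri≈ _ x≈z _ | _ = ¬gap₁ (x , m , y , (λ v x<v v<y →
                let a , v∉ = free v x<v v<y
                in (a , β.<-respˡ-≈ x≈z x<v) , λ p → v∉ (inj₁ (inj₁ p))) , c₁ , c₂)
        ... | tri> _ _ z<x | _ = ¬gap₁ (x , m , y , (λ v x<v v<y →
                let a , v∉ = free v x<v v<y
                in (a , β.trans z<x x<v) , λ p → v∉ (inj₁ (inj₁ p))) , c₁ , c₂)

      -- One bisection: a piece is split off and `next` is the region left over. The direction from
      -- the piece to that region is recorded, since only steps with equal directions combine to a
      -- sequence.
      record Step (A : Pred ∣ β ∣ 0ℓ) : Set₁ where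
        field
          next      : Pred ∣ β ∣ 0ℓ
          next-gaps : Gaps n Z next
          next⊆     : ∀ v → next v → A v
          dir       : Dir
          lo hi     : ∣ β ∣
          piece     : Contains n (Between up Z lo hi)
          piece⊆    : ∀ v → Between up Z lo hi v → A v
          ordered   : ∀ u v → Between up Z lo hi u → next v → lt β dir u v

      Gaps-step : ∀ A → Gaps n Z A → Step A
      -- Any gap will do here, so the empty set is avoided. Its middle point z is where A is
      -- divided.
      Gaps-step A gaps with gaps (λ _ → ⊥) Finite-∅
      ... | x , z , y , free , c₁ , c₂ with Gaps-split A z gaps
      ...   | inj₁ g = record
        { next = Above A z ; next-gaps = g ; next⊆ = λ _ → proj₁ ; dir = up
        ; piece = c₁
        ; piece⊆ = λ { v (_ , lift x<v , lift v<z) → proj₁ (free v x<v (β.trans v<z z<y)) }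
        ; ordered = λ { u v (_ , _ , lift u<z) (_ , z<v) → β.trans u<z z<v }
        }
        where
        z<y : z β.< y
        -- The other half of the gap has a point, which lies between z and y.
        z<y = let _ , _ , lift l , lift r = Contains-point n c₂ in β.trans l r
      ...   | inj₂ g = record
        { next = Below A z ; next-gaps = g ; next⊆ = λ _ → proj₁ ; dir = down
        ; piece = c₂
        ; piece⊆ = λ { v (_ , lift z<v , lift v<y) → proj₁ (free v (β.trans x<z z<v) v<y) }
        ; ordered = λ { u v (_ , lift z<u , _) (_ , v<z) → β.trans v<z z<u }
        }
        where
        x<z : x β.< z
        x<z = let _ , _ , lift l , lift r = Contains-point n c₁ in β.trans l r

      Gaps⇒Contains : Gaps n Z (λ _ → ⊤) → Contains (suc n) Z
      Gaps⇒Contains gaps = conclude (infinite-pigeonhole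
        (λ i → Lift _ (dir (step i) ≡ up)) (λ i → Lift _ (dir (step i) ≡ down)) up-or-down)
        where
        open Step
        stage : ℕ → Σ (Pred ∣ β ∣ 0ℓ) (Gaps n Z)
        step  : ∀ i → Step (proj₁ (stage i))
        stage zero    = (λ _ → ⊤) , gaps
        stage (suc i) = next (step i) , next-gaps (step i)
        step i = Gaps-step (proj₁ (stage i)) (proj₂ (stage i))
        decreasing : ∀ {i j} → i ℕ.≤′ j → ∀ v → proj₁ (stage j) v → proj₁ (stage i) v
        decreasing (ℕ.≤′-reflexive refl) v = id
        decreasing (ℕ.≤′-step {j} i≤j)   v = decreasing i≤j v ∘ next⊆ (step j) v
        up-or-down : ∀ i → Lift (lsuc 0ℓ) (dir (step i) ≡ up) ⊎
                           Lift (lsuc 0ℓ) (dir (step i) ≡ down)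
        up-or-down i with dir (step i)
        ... | up   = inj₁ (lift refl)
        ... | down = inj₂ (lift refl)
        Piece : ℕ → ∣ β ∣ → Set₁
        Piece i = Between up Z (lo (step i)) (hi (step i))
        subsequence : ∀ d (s : ℕ → ℕ) → (∀ {i j} → i ℕ.< j → s i ℕ.< s j) →
                      (∀ i → Lift (lsuc 0ℓ) (dir (step (s i)) ≡ d)) → Contains (suc n) Z
        subsequence d s inc dir≡ = sequence⇒Contains n d (Piece ∘ s) (λ i → piece (step (s i)))
          (λ _ _ → proj₁)
          -- The later piece lies in its own stage, hence in the region left over by the earlier
          -- step.
          λ {i} {j} i<j u v p q → subst (λ d → lt β d u v) (lower (dir≡ i))
            (ordered (step (s i)) u v p
              (decreasing (ℕₚ.≤⇒≤′ (inc i<j)) v (piece⊆ (step (s j)) v q)))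
        conclude : _ → Contains (suc n) Z
        conclude (inj₁ (s , inc , q)) = subsequence up s inc q
        conclude (inj₂ (s , inc , q)) = subsequence down s inc q

  -- Correctness of the translations.

  module _ {A : Set} (w : Word A) where
    open Word w using (Pos; dom)

    Sat-rename : ∀ {ℒ n n′ m m′} (φ : Formula A ℒ n m) {s s′ S S′}
      {ρ : Fin n → Fin n′} {σ : Fin m → Fin m′} →
      (∀ i → lookup s′ (ρ i) ≡ lookup s i) → (∀ j → lookup S′ (σ j) ≡ lookup S j) →
      Sat w s′ S′ (rename ρ σ φ) ⇔ Sat w s S φ
    Sat-rename (x <′ y) ρ≡ σ≡ rewrite ρ≡ x | ρ≡ y = ⇔-id _
    Sat-rename (a at x) ρ≡ σ≡ rewrite ρ≡ x = ⇔-id _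
    Sat-rename (x ∈′ Y) ρ≡ σ≡ rewrite ρ≡ x | σ≡ Y = ⇔-id _
    Sat-rename (¬′ φ)   ρ≡ σ≡ = ¬-cong-⇔ (Sat-rename φ ρ≡ σ≡)
    Sat-rename (φ ∧′ ψ) ρ≡ σ≡ = Sat-rename φ ρ≡ σ≡ ×-⇔ Sat-rename ψ ρ≡ σ≡
    Sat-rename (φ ∨′ ψ) ρ≡ σ≡ = Sat-rename φ ρ≡ σ≡ ⊎-⇔ Sat-rename ψ ρ≡ σ≡
    Sat-rename (∃′ φ)   ρ≡ σ≡ = Σ-cong-⇔ λ x → Sat-rename φ (lookup-lift ρ≡ x) σ≡
    Sat-rename (∃∞ n φ) ρ≡ σ≡ = mk⇔
      (λ (X , r , h) → X , r , λ i x → to⇔ (Sat-rename φ (lookup-lift ρ≡ i) σ≡) (h i x))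
      (λ (X , r , h) → X , r , λ i x → from⇔ (Sat-rename φ (lookup-lift ρ≡ i) σ≡) (h i x))
    Sat-rename (∃cut φ) ρ≡ σ≡ = Σ-cong-⇔ λ Y → ⇔-id _ ×-⇔ Sat-rename φ ρ≡ (lookup-lift σ≡ Y)
    Sat-rename (∃fin φ) ρ≡ σ≡ = Σ-cong-⇔ λ Y → ⇔-id _ ×-⇔ Sat-rename φ ρ≡ (lookup-lift σ≡ Y)

    Sat-less : ∀ {ℒ n m} d {x y : Fin n} {s} {S : Vec _ m} →
      Sat w s S (less {ℒ = ℒ} d x y) ⇔ Lift (lsuc 0ℓ) (lt dom d (lookup s x) (lookup s y))
    Sat-less up   = ⇔-id _
    Sat-less down = ⇔-id _

    Contains-cong : ∀ n {Y Z} → (∀ x → Y x ⇔ Z x) → Contains dom n Y ⇔ Contains dom n Z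
    Contains-cong n h = mk⇔ (Contains-⊆ dom n (to⇔ ∘ h)) (Contains-⊆ dom n (from⇔ ∘ h))

    ∃⇔Contains : ∀ {Z} → (∃[ x ] Z x) ⇔ Contains dom 0 Z
    ∃⇔Contains {Z} = mk⇔
      (λ (x , z) → (_≡ x) , lift (x , refl) , λ y y≡x → subst Z (sym y≡x) z)
      (Contains-point dom 0)

    module _ {ℒ n m} (φ : Formula A ℒ (suc n) m) (s : Vec Pos n) (S : Vec (Pred Pos 0ℓ) m) where

      Solution : Pos → Set₁
      Solution i = Sat w (i ∷ s) S φ

      Sat-between : ∀ d k {x y : Fin (k ℕ.+ n)} {t Y} → (∀ i → lookup t (k ↑ʳ i) ≡ lookup s i) →
        ∀ v → Sat w (v ∷ t) (Y ∷ S) (between d k x y φ) ⇔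
              Between dom d Solution (lookup t x) (lookup t y) v
      Sat-between d k t≡ v = Sat-rename φ (λ { 0F → refl ; (Fin.suc i) → t≡ i }) (λ _ → refl)
        ×-⇔ (Sat-less d ×-⇔ Sat-less d)

    Side : Dir → Pred Pos 0ℓ → Pred Pos 0ℓ
    Side up   Y = Y
    Side down Y = ∁ Y

    Sat-onSide : ∀ {ℒ n m} d {x Y} {s : Vec _ n} {S : Vec _ m} →
                 Sat w (x ∷ s) (Y ∷ S) (onSide {ℒ = ℒ} d) ⇔ Side d Y x
    Sat-onSide up   = mk⇔ lower lift
    Sat-onSide down = mk⇔ (λ h y → h (lift y)) (λ h (lift y) → h y)

    Sat-limit : ∀ {ℒ n m} d (ψ : Formula A ℒ (suc (suc n)) (suc m)) {s S Y} k {Z} →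
      (∀ x y → Sat w (y ∷ x ∷ s) (Y ∷ S) ψ ⇔ Contains dom k (Between dom d Z x y)) →
      Sat w s (Y ∷ S) (limit d ψ) ⇔ Limit dom k d Z (Side d Y)
    Sat-limit d ψ {s} {S} {Y} k {Z} h = mk⇔
      (λ ((x , p) , q) → (x , to⇔ (Sat-onSide d) p) , λ x p → dne λ none →
        q (x , from⇔ (Sat-onSide d) p , λ (y , a , b , c) →
          none (y , to⇔ (Sat-onSide d) a , lower (to⇔ (Sat-less d) b) , to⇔ (h x y) c)))
      (λ ((x , p) , q) → (x , from⇔ (Sat-onSide d) p) , λ (x , a , none) →
        let y , b , c , e = q x (to⇔ (Sat-onSide d) a)
        in none (y , from⇔ (Sat-onSide d) b , from⇔ (Sat-less d) (lift c) , from⇔ (h x y) e))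

    Sat-containsᶜ : ∀ k {n m} (φ : Formula A FO[cut] (suc n) m) {s S} →
      Sat w s S (containsᶜ k φ) ⇔ Contains dom k (λ i → Sat w (i ∷ s) S φ)
    Sat-containsᶜ zero    φ = ∃⇔Contains
    Sat-containsᶜ (suc k) φ {s} {S} = mk⇔
      (λ { (Y , _ , inj₁ l) → Limit⇒Contains dom k up (to⇔ (sat-limit up) l)
         ; (Y , _ , inj₂ l) → Limit⇒Contains dom k down (to⇔ (sat-limit down) l) })
      (λ c → from (Contains⇒Limit dom k c))
      where
      sat-limit : ∀ d {Y} → Sat w s (Y ∷ S) (limit d (containsᶜ k (between d 2 1F 0F φ))) ⇔
                            Limit dom k d (Solution φ s S) (Side d Y)
      sat-limit d = Sat-limit d _ k λ x y →
        Contains-cong k (Sat-between φ s S d 2 {1F} {0F} (λ _ → refl)) ⇔-∘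
          Sat-containsᶜ k (between d 2 1F 0F φ)
      from : _ → Sat w s S (containsᶜ (suc k) φ)
      from (up , Y , closed , l) = Y , closed , inj₁ (from⇔ (sat-limit up) l)
      -- For `down`, Y is right-closed, so the cut is its complement. The side described by
      -- `limit down` is then the double complement, and excluded middle gives back Y.
      from (down , Y , closed , (x , p) , next) = ∁ Y , (λ y<x x∉ y∈ → x∉ (closed y<x y∈)) ,
        inj₂ (from⇔ (sat-limit down) ((x , λ x∉ → x∉ p) , λ x p →
          let y , q , r = next x (decidable-stable (em₀ (Y x)) p) in y , (λ y∉ → y∉ q) , r))

    Sat-containsᶠ : ∀ k {n m} (φ : Formula A WMSO (suc n) m) {s S} →
      Sat w s S (containsᶠ k φ) ⇔ Contains dom k (λ i → Sat w (i ∷ s) S φ)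
    Sat-containsᶠ zero    φ = ∃⇔Contains
    Sat-containsᶠ (suc k) φ {s} {S} = mk⇔
      (λ h → Gaps⇒Contains dom λ F fin → dne λ ¬gap → h (F , fin , λ (x , z , y , free , c₁ , c₂) →
        ¬gap (x , z , y ,
          (λ v x<v v<y → tt , λ Fv → free (v , lift Fv , lift x<v , lift v<y)) ,
          to⇔ (sat-contains 2F 1F) c₁ , to⇔ (sat-contains 1F 0F) c₂)))
      (λ c (F , fin , none) → let x , z , y , free , c₁ , c₂ = Contains⇒Gaps dom k c F fin in
        none (x , z , y ,
          (λ (v , lift Fv , lift x<v , lift v<y) → proj₂ (free v x<v v<y) Fv) ,
          from⇔ (sat-contains 2F 1F) c₁ , from⇔ (sat-contains 1F 0F) c₂))
      where
      sat-contains : ∀ a b {x z y F} →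
        Sat w (y ∷ z ∷ x ∷ s) (F ∷ S) (containsᶠ k (between up 3 a b φ)) ⇔
        Contains dom k (Between dom up (Solution φ s S)
          (lookup (y ∷ z ∷ x ∷ s) a) (lookup (y ∷ z ∷ x ∷ s) b))
      sat-contains a b =
        Contains-cong k (Sat-between φ s S up 3 {a} {b} (λ _ → refl)) ⇔-∘
        Sat-containsᶠ k (between up 3 a b φ)

    module _ {ℒ} (c : ∀ {n m} → ℕ → Formula A ℒ (suc n) m → Formula A ℒ n m)
      (Sat-c : ∀ k {n m} (φ : Formula A ℒ (suc n) m) {s S} →
               Sat w s S (c k φ) ⇔ Contains dom k (λ i → Sat w (i ∷ s) S φ)) where

      Sat-eliminate-∃∞ : ∀ {n m} (φ : Formula A FO[∞] n m) {s S} →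
                         Sat w s S φ ⇔ Sat w s S (eliminate-∃∞ c φ)
      Sat-eliminate-∃∞ (x <′ y) = ⇔-id _
      Sat-eliminate-∃∞ (a at x) = ⇔-id _
      Sat-eliminate-∃∞ (x ∈′ Y) = ⇔-id _
      Sat-eliminate-∃∞ (¬′ φ)   = ¬-cong-⇔ (Sat-eliminate-∃∞ φ)
      Sat-eliminate-∃∞ (φ ∧′ ψ) = Sat-eliminate-∃∞ φ ×-⇔ Sat-eliminate-∃∞ ψ
      Sat-eliminate-∃∞ (φ ∨′ ψ) = Sat-eliminate-∃∞ φ ⊎-⇔ Sat-eliminate-∃∞ ψ
      Sat-eliminate-∃∞ (∃′ φ)   = Σ-cong-⇔ λ _ → Sat-eliminate-∃∞ φ
      -- Read from the last equivalence to the first: rank n is traded for `D n`, then φ for its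
      -- translation, then `Contains` for the formula built by c.
      Sat-eliminate-∃∞ (∃∞ n φ) {s} {S} = ⇔-sym (Sat-c n (eliminate-∃∞ c φ)) ⇔-∘
        (Contains-cong n (λ _ → Sat-eliminate-∃∞ φ) ⇔-∘
         mk⇔ (HasSubsetOfRank⇒Contains dom n) (Contains⇒HasSubsetOfRank dom n))

theorem6 : ExcludedMiddle (lsuc 0ℓ) →
    ∀ {A : Set} {k} → A ↔ Fin k →
    ∀ (L : Language A) → DefinableIn FO[∞] L →
    DefinableIn FO[cut] L × DefinableIn WMSO L
theorem6 em _ L (φ , L⇔φ) =
  (eliminate-∃∞ containsᶜ φ ,
    λ w → Sat-eliminate-∃∞ w containsᶜ (Sat-containsᶜ w) φ ⇔-∘ L⇔φ w) ,
  (eliminate-∃∞ containsᶠ φ ,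
    λ w → Sat-eliminate-∃∞ w containsᶠ (Sat-containsᶠ w) φ ⇔-∘ L⇔φ w)
  where open Classical em
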